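{- Let $T=\{2134,2341,2413\}$. Then $$F_T(x)=\frac{1-6x+10x^2-3x^3+x^4}{(1-3x+x^2)(1-4x+2x^2)}.$$
   Context: $S_n(T)$ denotes the set of permutations $\pi$ of $[n]=\{1,\dots,n\}$ (one-line notation) that avoid every pattern $\tau\in T$, i.e. no subsequence of $\pi$ is order-isomorphic to $\tau$. $F_T(x)=\sum_{n\ge 0}|S_n(T)|x^n$, a formal power series, with $|S_0(T)|=1$. -}

module Defs where

open import Data.Fin as Fin using (Fin; toℕ)
import Data.Fin.Properties as Fin
open import Data.Integer as ℤ using (ℤ; +_; -_; 0ℤ; 1ℤ)
import Data.Integer.Properties as ℤ
open import Data.List using (List; []; _∷_; length; filter; allFin; cartesianProductWith)
open import Data.List.Membership.Propositional using (_∈_)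
open import Data.List.Membership.Propositional.Properties using (∈-allFin; ∈-cartesianProductWith⁺)
open import Data.List.Relation.Unary.All as All using (All)
import Data.List.Relation.Unary.AllPairs as ListAllPairs
open import Data.List.Relation.Unary.Any as Any using (here)
import Data.List.Relation.Unary.Unique.Propositional as List using (Unique)
import Data.List.Relation.Unary.Unique.Propositional.Properties as ListUnique
open import Data.Nat as ℕ using (ℕ; zero; suc; _∸_)
import Data.Nat.Properties as ℕ
open import Data.Product using (∃-syntax; _×_; _,_)
open import Data.Vec as Vec using (Vec; []; _∷_; lookup; fromList)
open import Data.Vec.Properties using (∷-injective)
open import Data.Vec.Relation.Unary.AllPairs using (AllPairs; allPairs?)
open import Data.Vec.Relation.Unary.Unique.Propositional using (Unique)
open import Function using (_∘_; _⇔_; mk⇔; Equivalence)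
open import Relation.Binary.PropositionalEquality
  using (_≗_; refl; cong; module ≡-Reasoning)
open import Relation.Nullary using (¬_; Dec)
open import Relation.Nullary.Decidable using (map′; ¬?; _×-dec_; _→-dec_; True; toWitness)
open import Relation.Unary using (Decidable)
open import Algebra.Properties.Semiring.Sum ℤ.+-*-semiring using (sum)

infix 4 _contains_ _contains?_ _avoids_ _avoids?_

words : ∀ n k → List (Vec (Fin n) k)
words n zero    = [] ∷ []
words n (suc k) = cartesianProductWith _∷_ (allFin n) (words n k)

words-complete : ∀ {n k} (w : Vec (Fin n) k) → w ∈ words n k
words-complete []      = here refl
words-complete (i ∷ w) = ∈-cartesianProductWith⁺ _∷_ (∈-allFin i) (words-complete w)

words-unique : ∀ n k → List.Unique (words n k)
words-unique n zero    = All.[] ListAllPairs.∷ ListAllPairs.[]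
words-unique n (suc k) =
  ListUnique.cartesianProductWith⁺ _∷_ ∷-injective (ListUnique.allFin⁺ n) (words-unique n k)

-- One-line notation: n pairwise distinct letters from an n-letter alphabet.
-- The letter i : Fin n stands for the value suc (toℕ i) of [n].
IsPermutation : ∀ {n} → Vec (Fin n) n → Set
IsPermutation = Unique

isPermutation? : ∀ {n} → Decidable (IsPermutation {n})
isPermutation? = allPairs? (λ i j → ¬? (i Fin.≟ j))

OrderIsomorphic : ∀ {k} → Vec ℕ k → Vec ℕ k → Set
OrderIsomorphic u v = ∀ a b → lookup u a ℕ.< lookup u b ⇔ lookup v a ℕ.< lookup v b

orderIsomorphic? : ∀ {k} (u v : Vec ℕ k) → Dec (OrderIsomorphic u v)
orderIsomorphic? u v = Fin.all? λ a → Fin.all? λ b →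
  let P? = lookup u a ℕ.<? lookup u b
      Q? = lookup v a ℕ.<? lookup v b
  in map′ (λ (f , g) → mk⇔ f g) (λ e → Equivalence.to e , Equivalence.from e)
          ((P? →-dec Q?) ×-dec (Q? →-dec P?))

-- Patterns are written with their usual letters 1, 2, …
Pattern : Set
Pattern = List ℕ

-- The list of positions is increasing, so the selected letters form a
-- subsequence of π.
OccursAt : ∀ {n} (π : Vec (Fin n) n) (τ : Pattern) → Vec (Fin n) (length τ) → Set
OccursAt π τ is =
  AllPairs Fin._<_ is × OrderIsomorphic (Vec.map (toℕ ∘ lookup π) is) (fromList τ)

_contains_ : ∀ {n} → Vec (Fin n) n → Pattern → Set
π contains τ = ∃[ is ] OccursAt π τ is

_contains?_ : ∀ {n} (π : Vec (Fin n) n) (τ : Pattern) → Dec (π contains τ)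
_contains?_ {n} π τ =
  map′ Any.satisfied (λ (is , p) → Any.map (λ { refl → p }) (words-complete is))
       (Any.any? occursAt? (words n (length τ)))
  where
  occursAt? : Decidable (OccursAt π τ)
  occursAt? is = allPairs? Fin._<?_ is ×-dec orderIsomorphic? (Vec.map (toℕ ∘ lookup π) is) (fromList τ)

_avoids_ : ∀ {n} → Vec (Fin n) n → List Pattern → Set
π avoids T = All (λ τ → ¬ π contains τ) T

_avoids?_ : ∀ {n} (π : Vec (Fin n) n) (T : List Pattern) → Dec (π avoids T)
π avoids? T = All.all? (λ τ → ¬? (π contains? τ)) T

S : ∀ n → List Pattern → List (Vec (Fin n) n)
S n T = filter (λ π → isPermutation? π ×-dec π avoids? T) (words n n)

-- Formal power series, as coefficient sequences.
Series : Set
Series = ℕ → ℤ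

poly : List ℤ → Series
poly []       _       = 0ℤ
poly (c ∷ cs) zero    = c
poly (c ∷ cs) (suc n) = poly cs n

infixl 7 _⊛_ _⊘_

_⊛_ : Series → Series → Series
(f ⊛ g) n = sum {suc n} λ i → f (toℕ i) ℤ.* g (n ∸ toℕ i)

-- Long division by a series with constant term 1: the remainder after the
-- first step, f - f(0) g, is divisible by x. See ⊘-⊛ for correctness.
_⊘_ : (f g : Series) {g₀≡1 : True (g 0 ℤ.≟ 1ℤ)} → Series
(f ⊘ g)        zero    = f 0
(f ⊘ g) {g₀≡1} (suc n) = ((λ m → f (suc m) ℤ.- f 0 ℤ.* g (suc m)) ⊘ g) {g₀≡1} n

⊘-⊛ : ∀ f g {g₀≡1 : True (g 0 ℤ.≟ 1ℤ)} → (f ⊘ g) {g₀≡1} ⊛ g ≗ f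
⊘-⊛ f g {p} zero = begin
  f 0 ℤ.* g 0 ℤ.+ 0ℤ  ≡⟨ ℤ.+-identityʳ _ ⟩
  f 0 ℤ.* g 0         ≡⟨ cong (f 0 ℤ.*_) (toWitness p) ⟩
  f 0 ℤ.* 1ℤ          ≡⟨ ℤ.*-identityʳ _ ⟩
  f 0                 ∎
  where open ≡-Reasoning
⊘-⊛ f g {p} (suc n) = begin
  c ℤ.+ ((r ⊘ g) {p} ⊛ g) n    ≡⟨ cong (λ z → c ℤ.+ z) (⊘-⊛ r g {p} n) ⟩
  c ℤ.+ (f (suc n) ℤ.- c)      ≡⟨ ℤ.+-comm c _ ⟩
  f (suc n) ℤ.- c ℤ.+ c        ≡⟨ ℤ.+-assoc (f (suc n)) (- c) c ⟩
  f (suc n) ℤ.+ (- c ℤ.+ c)    ≡⟨ cong (λ z → f (suc n) ℤ.+ z) (ℤ.+-inverseˡ c) ⟩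
  f (suc n) ℤ.+ 0ℤ             ≡⟨ ℤ.+-identityʳ _ ⟩
  f (suc n)                    ∎
  where
  open ≡-Reasoning
  c = f 0 ℤ.* g (suc n)
  r : Series
  r m = f (suc m) ℤ.- f 0 ℤ.* g (suc m)

F : List Pattern → Series
F T n = + length (S n T)

{-# OPTIONS --safe #-}

-- Each pattern is a 2 followed by a rotation of 1 3 4. Hence a letter with
-- exactly m greater letters can be prepended to an avoider of length n iff
-- m = n or the m greatest letters are consecutive and decreasing when the
-- avoider is read cyclically. So m ranges over 0, …, k and n, where k < n is
-- the greatest length of such a run, and how k changes depends only on where
-- the run meets the two ends of the word. This generates the avoiders by a tree
-- with labels A k, B k, C j l, D k, whose numbers of descendants obey linear
-- recurrences that eliminate down to one of order four for D 0, the label of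
-- the one-letter word.
module Submission where

open import Defs
open import Algebra.Properties.AbelianGroup using (∙-cancelʳ)
import Data.Integer.Properties as ℤ
open import Data.Integer.Tactic.RingSolver using (solve-∀)
open import Data.List using (List; []; _∷_; length)
open import Data.Nat as ℕ using (ℕ; zero; suc)
import Data.Nat.Properties as ℕ
open import Function using (_∘_; id; mk⇔; Equivalence)
open import Relation.Binary.PropositionalEquality
  using (_≡_; _≢_; _≗_; refl; sym; trans; cong; cong₂; subst; subst₂; module ≡-Reasoning)
open import Relation.Nullary.Decidable using (True; toWitness; _×-dec_)

-- A prepended letter lands exactly where the cyclic word is cut. To join the run it needs the
-- smaller ranks of the run at the end of the word and the larger ones at the front, so the way the
-- cut divides the run decides everything. For thresholds up to its own rank the new letter lies
-- outside the run, and the cyclic order condition turns into a linear one. The obstacle to counting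
-- is the infinite supply of labels: `B k`, `D k` and `C j l` have children `B (suc k)`, `D (suc k)`
-- and `C j (suc l)`. The parameter `l` is harmless because the counts are affine in it; eliminating
-- it yields the factor 1 - 3x + x². The chains in `k` are summed along diagonals, which preserves
-- linear relations whose coefficients do not depend on `k`. At `k = 1` the summed system closes up,
-- because the children of every `A k` begin with `B 1`; this yields the factor 1 - 4x + 2x².

module Tree where

  open import Data.Empty using (⊥; ⊥-elim)
  open import Data.Fin as Fin using (Fin; zero; suc; toℕ; fromℕ; opposite; punchIn; punchOut)
  open import Data.Fin.Patterns using (0F; 1F; 2F; 3F)
  import Data.Fin.Properties as Fin
  open import Data.List using (_++_; map; filter; allFin; tabulate; cartesianProductWith)
  open import Data.List.Membership.Propositional using (_∈_)
  open import Data.List.Membership.Propositional.Properties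
    using (∈-filter⁺; ∈-filter⁻; ∈-cartesianProductWith⁺; ∈-cartesianProductWith⁻; ∈-allFin)
  open import Data.List.Membership.Propositional.Properties.WithK using (unique∧set⇒bag)
  import Data.List.Properties as List
  open import Data.List.Relation.Binary.BagAndSetEquality using (∼bag⇒↭)
  open import Data.List.Relation.Binary.Permutation.Propositional.Properties using (↭-length)
  import Data.List.Relation.Unary.All as List using ([]; _∷_)
  import Data.List.Relation.Unary.AllPairs as ListAllPairs
  open import Data.List.Relation.Unary.Any using (here)
  import Data.List.Relation.Unary.Unique.Propositional as List using (Unique)
  import Data.List.Relation.Unary.Unique.Propositional.Properties as ListUnique
  open import Data.Nat using (_+_; _≤_; _<_; _≤?_; z≤n; s≤s; z<s; s<s; s≤s⁻¹; s<s⁻¹)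
  open import Data.Nat.ListAction using (sum)
  open import Data.Nat.ListAction.Properties using (sum-++)
  open import Data.Nat.Properties
  open import Data.Product using (∃-syntax; _×_; _,_; proj₁; proj₂)
  open import Data.Sum using (_⊎_; inj₁; inj₂; [_,_])
  open import Data.Vec as Vec using (Vec; []; _∷_; lookup)
  open import Data.Vec.Properties using (lookup-map; ∷-injective)
  open import Data.Vec.Relation.Unary.All as VecAll using (All; []; _∷_)
  import Data.Vec.Relation.Unary.All.Properties as VecAll
  open import Data.Vec.Relation.Unary.AllPairs using (AllPairs; []; _∷_)
  open import Data.Vec.Relation.Unary.Unique.Propositional using (Unique)
  import Data.Vec.Relation.Unary.Unique.Propositional.Properties as VecUnique
  open import Relation.Binary.Definitions using (tri<; tri≈; tri>)
  open import Relation.Nullary using (¬_; yes; no; contradiction)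
  open import Relation.Unary using (Decidable)

  -- Ranks under prepending a letter

  bump : ℕ → ℕ → ℕ
  bump zero    x       = suc x
  bump (suc i) zero    = zero
  bump (suc i) (suc x) = suc (bump i x)

  bump-below : ∀ {i x} → x < i → bump i x ≡ x
  bump-below {suc i} {zero}  _   = refl
  bump-below {suc i} {suc x} x<i = cong suc (bump-below (s<s⁻¹ x<i))

  bump-above : ∀ {i x} → i ≤ x → bump i x ≡ suc x
  bump-above {zero}          _   = refl
  bump-above {suc i} {suc x} i≤x = cong suc (bump-above (s≤s⁻¹ i≤x))

  infixr 5 _◂_

  -- `bump i` is the increasing map that omits the value `i`: an old letter gains one greater letter
  -- exactly when the new one exceeds it.
  _◂_ : ∀ {n} → ℕ → (Fin n → ℕ) → Fin (suc n) → ℕ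
  (i ◂ f) zero    = i
  (i ◂ f) (suc p) = bump i (f p)

  bump-mono-< : ∀ i {x y} → x < y → bump i x < bump i y
  bump-mono-< zero                      = s<s
  bump-mono-< (suc i) {zero}  {suc y} _ = z<s
  bump-mono-< (suc i) {suc x} {suc y} p = s<s (bump-mono-< i (s<s⁻¹ p))

  bump-cancel-< : ∀ i {x y} → bump i x < bump i y → x < y
  bump-cancel-< zero                      = s<s⁻¹
  bump-cancel-< (suc i) {zero}  {suc y} _ = z<s
  bump-cancel-< (suc i) {suc x} {suc y} p = s<s (bump-cancel-< i (s<s⁻¹ p))

  -- A threshold `m ≤ i` is unchanged by `bump i`, while one with `i ≤ m` moves up to `suc m`. These
  -- are the low and high cases of the lemmas on `i ◂ f`; at `m = i` both apply.
  bump-<⁺ : ∀ {i m} x → m ≤ i → x < m → bump i x < m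
  bump-<⁺ {suc i} {suc m} zero    _       _ = z<s
  bump-<⁺ {suc i} {suc m} (suc x) (s≤s q) p = s<s (bump-<⁺ x q (s<s⁻¹ p))

  bump-<⁻ : ∀ {i m} x → m ≤ i → bump i x < m → x < m
  bump-<⁻ {suc i} {suc m} zero    _       _ = z<s
  bump-<⁻ {suc i} {suc m} (suc x) (s≤s q) p = s<s (bump-<⁻ x q (s<s⁻¹ p))

  bump-≥⁺ : ∀ {i m} x → m ≤ i → m ≤ x → m ≤ bump i x
  bump-≥⁺ x m≤i m≤x = ≮⇒≥ λ r → <⇒≱ (bump-<⁻ x m≤i r) m≤x

  bump-≥⁻ : ∀ {i m} x → m ≤ i → m ≤ bump i x → m ≤ x
  bump-≥⁻ x m≤i r = ≮⇒≥ λ x<m → <⇒≱ (bump-<⁺ x m≤i x<m) r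

  bump-≤⁺ : ∀ {i m} x → i ≤ m → x < m → bump i x < suc m
  bump-≤⁺ {zero}          x       _   x<m = s<s x<m
  bump-≤⁺ {suc i}         zero    _   x<m = z<s
  bump-≤⁺ {suc i} {suc m} (suc x) i≤m x<m = s<s (bump-≤⁺ x (s≤s⁻¹ i≤m) (s<s⁻¹ x<m))

  bump-≤⁻ : ∀ {i m} x → i ≤ m → bump i x < suc m → x < m
  bump-≤⁻ {zero}          x       _   r = s<s⁻¹ r
  bump-≤⁻ {suc i} {suc m} zero    _   r = z<s
  bump-≤⁻ {suc i} {suc m} (suc x) i≤m r = s<s (bump-≤⁻ x (s≤s⁻¹ i≤m) (s<s⁻¹ r))

  bump->⁺ : ∀ {i m} x → i ≤ m → m ≤ x → m < bump i x
  bump->⁺ x i≤m m≤x = ≰⇒> λ r → <⇒≱ (bump-≤⁻ x i≤m (s≤s r)) m≤x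

  bump->⁻ : ∀ {i m} x → i ≤ m → m < bump i x → m ≤ x
  bump->⁻ x i≤m r = ≮⇒≥ λ x<m → <⇒≱ (bump-≤⁺ x i≤m x<m) r

  -- Read cyclically from a letter that is at least h, two letters below m
  -- descend. For m = h = i this forbids i to be prepended (see _◂_); for
  -- m = o, h = suc o the disjuncts are the patterns 2134, 2341, 2413 with
  -- first letter of rank o.
  Bad : (m h x y z : ℕ) → Set
  Bad m h x y z =
    (z < y × y < m × h ≤ x) ⊎ (y < x × x < m × h ≤ z) ⊎ (x < z × z < m × h ≤ y)

  bad-map : ∀ {m h m′ h′} {φ : ℕ → ℕ} →
            (∀ {x y} → x < y → φ x < φ y) → (∀ x → x < m → φ x < m′) → (∀ x → h ≤ x → h′ ≤ φ x) →
            ∀ {x y z} → Bad m h x y z → Bad m′ h′ (φ x) (φ y) (φ z)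
  bad-map mono lo hi (inj₁ (a , b , c))        = inj₁ (mono a , lo _ b , hi _ c)
  bad-map mono lo hi (inj₂ (inj₁ (a , b , c))) = inj₂ (inj₁ (mono a , lo _ b , hi _ c))
  bad-map mono lo hi (inj₂ (inj₂ (a , b , c))) = inj₂ (inj₂ (mono a , lo _ b , hi _ c))

  bad-unmap : ∀ {m h m′ h′} {φ : ℕ → ℕ} →
              (∀ {x y} → φ x < φ y → x < y) → (∀ x → φ x < m′ → x < m) → (∀ x → h′ ≤ φ x → h ≤ x) →
              ∀ {x y z} → Bad m′ h′ (φ x) (φ y) (φ z) → Bad m h x y z
  bad-unmap mono lo hi (inj₁ (a , b , c))        = inj₁ (mono a , lo _ b , hi _ c)
  bad-unmap mono lo hi (inj₂ (inj₁ (a , b , c))) = inj₂ (inj₁ (mono a , lo _ b , hi _ c))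
  bad-unmap mono lo hi (inj₂ (inj₂ (a , b , c))) = inj₂ (inj₂ (mono a , lo _ b , hi _ c))

  Active : ∀ {n} → ℕ → (Fin n → ℕ) → Set
  Active m f = ∀ {p q r} → p Fin.< q → q Fin.< r → ¬ Bad m m (f p) (f q) (f r)

  Avoiding : ∀ {n} → (Fin n → ℕ) → Set
  Avoiding f = ∀ {o p q r} → o Fin.< p → p Fin.< q → q Fin.< r →
               ¬ Bad (f o) (suc (f o)) (f p) (f q) (f r)

  Increasing : ∀ {n} → ℕ → (Fin n → ℕ) → Set
  Increasing m f = ∀ {p q} → p Fin.< q → ¬ (f q < f p × f p < m)

  -- Here `x` stands before `y`. Excluding both disjuncts puts the letters in [i, m) before, and
  -- those below `i` after, every letter ≥ m. This is what lets a new letter of rank `i` at the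
  -- front join the cyclic run.
  Crossing : (i m x y : ℕ) → Set
  Crossing i m x y = (m ≤ x × i ≤ y × y < m) ⊎ (x < i × m ≤ y)

  -- Among the letters below m, those below i lie before every letter ≥ m and
  -- those from i on lie after it.
  Split : ∀ {n} → ℕ → ℕ → (Fin n → ℕ) → Set
  Split i m f = ∀ {p q} → p Fin.< q → ¬ Crossing i m (f p) (f q)

  -- How the order conditions change under prepending

  module _ {n} {f : Fin n → ℕ} where

    avoiding-◂ : ∀ {i} → Active i f → Avoiding f → Avoiding (i ◂ f)
    avoiding-◂ {i} act av {zero} {suc p} {suc q} {suc r} _ p<q q<r bad =
      act (s<s⁻¹ p<q) (s<s⁻¹ q<r)
        (bad-unmap (bump-cancel-< i) (λ x → bump-<⁻ x ≤-refl) (λ x → bump->⁻ x ≤-refl) bad)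
    avoiding-◂ {i} act av {suc o} {suc p} {suc q} {suc r} o<p p<q q<r bad =
      av (s<s⁻¹ o<p) (s<s⁻¹ p<q) (s<s⁻¹ q<r)
        (bad-unmap (bump-cancel-< i) (λ x → bump-cancel-< i) (λ x → bump-cancel-< i) bad)

    ◂-avoiding : ∀ {i} → Avoiding (i ◂ f) → Active i f × Avoiding f
    ◂-avoiding {i} av =
      (λ p<q q<r bad → av {zero} z<s (s<s p<q) (s<s q<r)
        (bad-map (bump-mono-< i) (λ x → bump-<⁺ x ≤-refl) (λ x → bump->⁺ x ≤-refl) bad)) ,
      (λ o<p p<q q<r bad → av (s<s o<p) (s<s p<q) (s<s q<r)
        (bad-map (bump-mono-< i) (λ x → bump-mono-< i) (λ x → bump-mono-< i) bad))

    module _ {i m} (m≤i : m ≤ i) where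

      -- The new letter is itself ≥ m, and reading cyclically from it means reading the old word
      -- linearly.
      active-low⁺ : Active m f → Increasing m f → Active m (i ◂ f)
      active-low⁺ act inc {zero} {suc q} {suc r} _ q<r (inj₁ (z<y , y<m , _)) =
        inc (s<s⁻¹ q<r) (bump-cancel-< i z<y , bump-<⁻ _ m≤i y<m)
      active-low⁺ act inc {zero} {suc q} {suc r} _ q<r (inj₂ (inj₁ (_ , i<m , _))) =
        <⇒≱ i<m m≤i
      active-low⁺ act inc {zero} {suc q} {suc r} _ q<r (inj₂ (inj₂ (i<z , z<m , _))) =
        <⇒≱ (<-trans i<z z<m) m≤i
      active-low⁺ act inc {suc p} {suc q} {suc r} p<q q<r bad =
        act (s<s⁻¹ p<q) (s<s⁻¹ q<r)
          (bad-unmap (bump-cancel-< i) (λ x → bump-<⁻ x m≤i) (λ x → bump-≥⁻ x m≤i) bad)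

      active-low⁻ : Active m (i ◂ f) → Active m f × Increasing m f
      active-low⁻ act =
        (λ p<q q<r bad → act (s<s p<q) (s<s q<r)
          (bad-map (bump-mono-< i) (λ x → bump-<⁺ x m≤i) (λ x → bump-≥⁺ x m≤i) bad)) ,
        (λ { p<q (y<x , x<m) → act {zero} z<s (s<s p<q)
          (inj₁ (bump-mono-< i y<x , bump-<⁺ _ m≤i x<m , m≤i)) })

      increasing-low⁺ : Increasing m f → Increasing m (i ◂ f)
      increasing-low⁺ inc {zero} {suc q} _ (_ , i<m) = <⇒≱ i<m m≤i
      increasing-low⁺ inc {suc p} {suc q} p<q (y<x , x<m) =
        inc (s<s⁻¹ p<q) (bump-cancel-< i y<x , bump-<⁻ _ m≤i x<m)

      split-low⁺ : Split m m f → Split m m (i ◂ f)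
      split-low⁺ spl {zero} {suc q} _ (inj₁ (_ , m≤y , y<m)) = <⇒≱ y<m m≤y
      split-low⁺ spl {zero} {suc q} _ (inj₂ (i<m , _)) = <⇒≱ i<m m≤i
      split-low⁺ spl {suc p} {suc q} _ (inj₁ (_ , m≤y , y<m)) = <⇒≱ y<m m≤y
      split-low⁺ spl {suc p} {suc q} p<q (inj₂ (x<m , m≤y)) =
        spl (s<s⁻¹ p<q) (inj₂ (bump-<⁻ _ m≤i x<m , bump-≥⁻ _ m≤i m≤y))

    module _ {i m} (i≤m : i ≤ m) where

      -- Of the three forms of `Bad` that involve the new letter, one would need it to be ≥ `suc m`;
      -- the other two are the two forms of `Crossing`.
      active-high⁺ : Active m f → Split i m f → Active (suc m) (i ◂ f)
      active-high⁺ act spl {zero} {suc q} {suc r} _ q<r (inj₁ (_ , _ , m<i)) = <⇒≱ m<i i≤m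
      active-high⁺ act spl {zero} {suc q} {suc r} _ q<r (inj₂ (inj₁ (y<i , _ , m<z))) =
        spl (s<s⁻¹ q<r) (inj₂ (bump-<⁻ _ ≤-refl y<i , bump->⁻ _ i≤m m<z))
      active-high⁺ act spl {zero} {suc q} {suc r} _ q<r (inj₂ (inj₂ (i<z , z≤m , m<y))) =
        spl (s<s⁻¹ q<r) (inj₁ (bump->⁻ _ i≤m m<y , bump->⁻ _ ≤-refl i<z , bump-≤⁻ _ i≤m z≤m))
      active-high⁺ act spl {suc p} {suc q} {suc r} p<q q<r bad =
        act (s<s⁻¹ p<q) (s<s⁻¹ q<r)
          (bad-unmap (bump-cancel-< i) (λ x → bump-≤⁻ x i≤m) (λ x → bump->⁻ x i≤m) bad)

      active-high⁻ : Active (suc m) (i ◂ f) → Active m f × Split i m f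
      active-high⁻ act =
        (λ p<q q<r bad → act (s<s p<q) (s<s q<r)
          (bad-map (bump-mono-< i) (λ x → bump-≤⁺ x i≤m) (λ x → bump->⁺ x i≤m) bad)) ,
        (λ { p<q (inj₁ (m≤x , i≤y , y<m)) → act {zero} z<s (s<s p<q)
               (inj₂ (inj₂ (bump->⁺ _ ≤-refl i≤y , bump-≤⁺ _ i≤m y<m , bump->⁺ _ i≤m m≤x)))
           ; p<q (inj₂ (x<i , m≤y)) → act {zero} z<s (s<s p<q)
               (inj₂ (inj₁ (bump-<⁺ _ ≤-refl x<i , s≤s i≤m , bump->⁺ _ i≤m m≤y))) })

      increasing-high⁻ : Increasing (suc m) (i ◂ f) → Increasing m f
      increasing-high⁻ inc p<q (y<x , x<m) =
        inc (s<s p<q) (bump-mono-< i y<x , bump-≤⁺ _ i≤m x<m)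

      split-high⁺ : ∀ {j} → j ≤ i → Split j m f → Split j (suc m) (i ◂ f)
      split-high⁺ j≤i spl {zero} {suc q} _ (inj₁ (m<i , _)) = <⇒≱ m<i i≤m
      split-high⁺ j≤i spl {zero} {suc q} _ (inj₂ (i<j , _)) = <⇒≱ i<j j≤i
      split-high⁺ j≤i spl {suc p} {suc q} p<q (inj₁ (m<x , j≤y , y≤m)) =
        spl (s<s⁻¹ p<q) (inj₁ (bump->⁻ _ i≤m m<x , bump-≥⁻ _ j≤i j≤y , bump-≤⁻ _ i≤m y≤m))
      split-high⁺ j≤i spl {suc p} {suc q} p<q (inj₂ (x<j , m<y)) =
        spl (s<s⁻¹ p<q) (inj₂ (bump-<⁻ _ j≤i x<j , bump->⁻ _ i≤m m<y))

    increasing-zero⁺ : ∀ {m} → Increasing m f → Increasing (suc m) (0 ◂ f)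
    increasing-zero⁺ inc {suc p} {suc q} p<q (y<x , x<m) =
      inc (s<s⁻¹ p<q) (s<s⁻¹ y<x , s<s⁻¹ x<m)

  -- `onto` produces a letter of any prescribed rank; the converse lemmas refute a misplaced new
  -- letter by comparing it with such a letter.
  record Ranking {n} (f : Fin n → ℕ) : Set where
    field
      bounded : ∀ p → f p < n
      onto    : ∀ {x} → x < n → ∃[ p ] f p ≡ x

  open Ranking

  ranking-◂ : ∀ {n i} {f : Fin n → ℕ} → i ≤ n → Ranking f → Ranking (i ◂ f)
  ranking-◂ i≤n rk .bounded zero    = s≤s i≤n
  ranking-◂ i≤n rk .bounded (suc p) = bump-≤⁺ _ i≤n (bounded rk p)
  ranking-◂ {i = i} i≤n rk .onto {x} x≤n with <-cmp x i
  ... | tri≈ _ refl _ = zero , refl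
  ... | tri< x<i _ _  = let p , e = onto rk (<-≤-trans x<i i≤n)
                        in suc p , trans (cong (bump i) e) (bump-below x<i)
  ranking-◂ {i = i} i≤n rk .onto {suc x} x≤n | tri> _ _ i≤x =
    let p , e = onto rk (s<s⁻¹ x≤n) in suc p , trans (cong (bump i) e) (bump-above (s≤s⁻¹ i≤x))

  module _ {n} {f : Fin n → ℕ} (rk : Ranking f) where

    active-top : Active n f
    active-top {r = r} _ _ (inj₁ (_ , _ , n≤x))        = <⇒≱ (bounded rk _) n≤x
    active-top         _ _ (inj₂ (inj₁ (_ , _ , n≤x))) = <⇒≱ (bounded rk _) n≤x
    active-top         _ _ (inj₂ (inj₂ (_ , _ , n≤x))) = <⇒≱ (bounded rk _) n≤x

    split-top : ∀ {i} → Split i n f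
    split-top _ (inj₁ (n≤x , _)) = <⇒≱ (bounded rk _) n≤x
    split-top _ (inj₂ (_ , n≤y)) = <⇒≱ (bounded rk _) n≤y

    increasing-high : ∀ {i m} → i ≤ m → i ≤ n → Increasing (suc m) (i ◂ f) → i ≡ 0
    increasing-high {zero}  i≤m i≤n inc = refl
    increasing-high {suc i} i≤m i≤n inc =
      let p , e = onto rk {0} (≤-trans z<s i≤n)
      in ⊥-elim (inc {zero} {suc p} z<s (subst (λ x → bump (suc i) x < suc i) (sym e) z<s , s≤s i≤m))

    -- The new letter is ≥ m and stands first. If `j < m`, the letter of rank `j` would have to
    -- precede it.
    split-low⁻ : ∀ {i j m} → m ≤ i → i ≤ n → j ≤ m → Split j m (i ◂ f) → j ≡ m × Split m m f
    split-low⁻ {i} {j} {m} m≤i i≤n j≤m spl with m≤n⇒m<n∨m≡n j≤m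
    ... | inj₂ refl = refl , λ where
      _   (inj₁ (_ , m≤y , y<m)) → <⇒≱ y<m m≤y
      p<q (inj₂ (x<m , m≤y))     → spl (s<s p<q) (inj₂ (bump-<⁺ _ m≤i x<m , bump-≥⁺ _ m≤i m≤y))
    ... | inj₁ j<m =
      let p , e = onto rk (<-≤-trans j<m (≤-trans m≤i i≤n))
      in ⊥-elim (spl {zero} {suc p} z<s
           (inj₁ (m≤i , bump-≥⁺ _ (≤-trans j≤m m≤i) (≤-reflexive (sym e)) ,
                  bump-<⁺ _ m≤i (subst (_< m) (sym e) j<m))))

    -- If `i < j`, the new letter would have to follow every letter ≥ `suc m`; it stands first, and
    -- the old letter of rank `m` becomes such a letter.
    split-high⁻ : ∀ {i j m} → i ≤ m → m < n → Split j (suc m) (i ◂ f) → j ≤ i × Split j m f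
    split-high⁻ {i} {j} {m} i≤m m<n spl = j≤i , λ where
        p<q (inj₁ (m≤x , j≤y , y<m)) →
          spl (s<s p<q) (inj₁ (bump->⁺ _ i≤m m≤x , bump-≥⁺ _ j≤i j≤y , bump-≤⁺ _ i≤m y<m))
        p<q (inj₂ (x<j , m≤y)) →
          spl (s<s p<q) (inj₂ (bump-<⁺ _ j≤i x<j , bump->⁺ _ i≤m m≤y))
      where
      j≤i : j ≤ i
      j≤i = ≮⇒≥ λ i<j → let p , e = onto rk m<n in
        spl {zero} {suc p} z<s (inj₂ (i<j , bump->⁺ _ i≤m (≤-reflexive (sym e))))

  -- The state of the cyclic run and its transitions

  -- Letters are ranks. The letters below k form a maximal contiguous increasing
  -- run of the cyclic word, those below q also increase linearly, and P holds of
  -- the number of letters of the run that precede the point where the cyclic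
  -- word is cut.
  record State (k q : ℕ) (P : ℕ → Set) {n} (f : Fin n → ℕ) : Set where
    field
      ranking : Ranking f
      k<n     : k < n
      q≤k     : q ≤ k
      act     : ∀ {m} → m ≤ k → Active m f
      ¬act    : ∀ {m} → k < m → m < n → ¬ Active m f
      inc     : ∀ {m} → m ≤ q → Increasing m f
      ¬inc    : ∀ {m} → q < m → m ≤ k → ¬ Increasing m f
      split   : ∀ {i m} → 0 < m → m ≤ k → i ≤ m → P i → Split i m f
      ¬split  : ∀ {i m} → 0 < m → m ≤ k → i ≤ m → Split i m f → P i

  open State

  active-zero : ∀ {n} {f : Fin n → ℕ} → Active 0 f
  active-zero _ _ (inj₁ (_ , () , _))
  active-zero _ _ (inj₂ (inj₁ (_ , () , _)))
  active-zero _ _ (inj₂ (inj₂ (_ , () , _)))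

  increasing-zero : ∀ {n} {f : Fin n → ℕ} → Increasing 0 f
  increasing-zero _ (_ , ())

  -- The reason for `0 < m` in `State`: with no letter below the threshold the word is always split,
  -- although `P 0` may be false.
  split-zero : ∀ {n} {f : Fin n → ℕ} → Split 0 0 f
  split-zero _ (inj₁ (_ , _ , ()))
  split-zero _ (inj₂ (() , _))

  module _ {n} {f : Fin n → ℕ} where

    extend-front : ∀ {k} → State k k (_≡ 0) f → State (suc k) (suc k) (_≡ 0) (0 ◂ f)
    extend-front s .ranking = ranking-◂ z≤n (ranking s)
    extend-front s .k<n = s<s (k<n s)
    extend-front s .q≤k = ≤-refl
    extend-front s .act {zero} _ = active-zero
    extend-front s .act {suc zero} _ = active-high⁺ z≤n active-zero split-zero
    extend-front s .act {suc (suc m)} le =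
      active-high⁺ z≤n (act s (s≤s⁻¹ le)) (split s z<s (s≤s⁻¹ le) z≤n refl)
    extend-front s .¬act {suc m} k<m m<n a =
      ¬act s (s<s⁻¹ k<m) (s<s⁻¹ m<n) (proj₁ (active-high⁻ z≤n a))
    extend-front s .inc {zero} _ = increasing-zero
    extend-front s .inc {suc m} le = increasing-zero⁺ (inc s (s≤s⁻¹ le))
    extend-front s .¬inc q<m m≤k = ⊥-elim (<⇒≱ q<m m≤k)
    extend-front s .split {m = suc zero} _ _ _ refl = split-high⁺ z≤n z≤n split-zero
    extend-front s .split {m = suc (suc m)} _ le _ refl =
      split-high⁺ z≤n z≤n (split s z<s (s≤s⁻¹ le) z≤n refl)
    extend-front s .¬split {m = suc m} _ le _ spl =
      n≤0⇒n≡0 (proj₁ (split-high⁻ (ranking s) z≤n (≤-<-trans (s≤s⁻¹ le) (k<n s)) spl))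

    -- The run has its letters below `j` at the end of the word and the others at the front, so rank
    -- `j` joins it right at the cut. Thresholds up to `j` see the new letter outside the run and
    -- higher ones see it inside, whence the case distinctions.
    extend-back : ∀ {k j} → 0 < j → State k j (_≡ j) f → State (suc k) j (_≡ j) (j ◂ f)
    extend-back 0<j s .ranking = ranking-◂ (≤-trans (q≤k s) (<⇒≤ (k<n s))) (ranking s)
    extend-back 0<j s .k<n = s<s (k<n s)
    extend-back 0<j s .q≤k = m≤n⇒m≤1+n (q≤k s)
    extend-back {j = j} 0<j s .act {m} le with m ≤? j
    ... | yes m≤j = active-low⁺ m≤j (act s (≤-trans m≤j (q≤k s))) (inc s m≤j)
    extend-back 0<j s .act {zero} le | no m≰j = ⊥-elim (m≰j z≤n)
    extend-back 0<j s .act {suc m} le | no m≰j =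
      active-high⁺ j≤m (act s (s≤s⁻¹ le)) (split s (<-≤-trans 0<j j≤m) (s≤s⁻¹ le) j≤m refl)
      where j≤m = s≤s⁻¹ (≰⇒> m≰j)
    extend-back 0<j s .¬act {suc m} k<m m<n a =
      ¬act s (s<s⁻¹ k<m) (s<s⁻¹ m<n)
        (proj₁ (active-high⁻ (≤-trans (q≤k s) (<⇒≤ (s<s⁻¹ k<m))) a))
    extend-back 0<j s .inc le = increasing-low⁺ le (inc s le)
    extend-back 0<j s .¬inc {suc m} q<m m≤k i =
      contradiction (increasing-high (ranking s) (s≤s⁻¹ q<m) (≤-trans (q≤k s) (<⇒≤ (k<n s))) i) (>⇒≢ 0<j)
    extend-back {j = j} 0<j s .split {m = m} 0<m le i≤m refl with m ≤? j
    ... | yes m≤j with ≤-antisym m≤j i≤m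
    ...   | refl = split-low⁺ m≤j (split s 0<m (q≤k s) ≤-refl refl)
    extend-back 0<j s .split {m = suc m} 0<m le i≤m refl | no m≰j =
      split-high⁺ j≤m ≤-refl (split s (<-≤-trans 0<j j≤m) (s≤s⁻¹ le) j≤m refl)
      where j≤m = s≤s⁻¹ (≰⇒> m≰j)
    extend-back {j = j} 0<j s .¬split {m = m} 0<m le i≤m spl with m ≤? j
    ... | yes m≤j = let i≡m , spl′ = split-low⁻ (ranking s) m≤j (≤-trans (q≤k s) (<⇒≤ (k<n s))) i≤m spl
                    in trans i≡m (¬split s 0<m (≤-trans m≤j (q≤k s)) ≤-refl spl′)
    extend-back 0<j s .¬split {m = suc m} 0<m le i≤m spl | no m≰j =
      let i≤j , spl′ = split-high⁻ (ranking s) j≤m (≤-<-trans (s≤s⁻¹ le) (k<n s)) spl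
      in ¬split s (<-≤-trans 0<j j≤m) (s≤s⁻¹ le) (≤-trans i≤j j≤m) spl′
      where j≤m = s≤s⁻¹ (≰⇒> m≰j)

    -- A letter of rank 0 is always a run by itself. By `¬ P 0` the old run does not stand at the
    -- front to continue it.
    restart : ∀ {k q P} → State k q P f → ¬ P 0 → State 1 1 (_≡ 0) (0 ◂ f)
    restart s ¬P0 .ranking = ranking-◂ z≤n (ranking s)
    restart s ¬P0 .k<n = s<s (≤-<-trans z≤n (k<n s))
    restart s ¬P0 .q≤k = ≤-refl
    restart s ¬P0 .act {zero} _ = active-zero
    restart s ¬P0 .act {suc zero} _ = active-high⁺ z≤n active-zero split-zero
    restart s ¬P0 .act {suc (suc m)} (s≤s ())
    restart {k} s ¬P0 .¬act {suc m} 1<m m<n a with m ≤? k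
    ... | yes m≤k = ¬P0 (¬split s (s<s⁻¹ 1<m) m≤k z≤n (proj₂ (active-high⁻ z≤n a)))
    ... | no  m≰k = ¬act s (≰⇒> m≰k) (s<s⁻¹ m<n) (proj₁ (active-high⁻ z≤n a))
    restart s ¬P0 .inc {zero} _ = increasing-zero
    restart s ¬P0 .inc {suc zero} _ = increasing-zero⁺ increasing-zero
    restart s ¬P0 .inc {suc (suc m)} (s≤s ())
    restart s ¬P0 .¬inc q<m m≤k = ⊥-elim (<⇒≱ q<m m≤k)
    restart s ¬P0 .split {m = suc zero} _ _ _ refl = split-high⁺ z≤n z≤n split-zero
    restart s ¬P0 .split {m = suc (suc m)} _ (s≤s ())
    restart s ¬P0 .¬split {m = suc zero} _ _ _ spl =
      n≤0⇒n≡0 (proj₁ (split-high⁻ (ranking s) z≤n (≤-<-trans z≤n (k<n s)) spl))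
    restart s ¬P0 .¬split {m = suc (suc m)} _ (s≤s ())

    -- A letter that does not fit cuts the run down to `r`, the minimum of `q` and `i`. For
    -- thresholds up to `i` it lies outside the run and demands linear increase, which ends at `q`.
    -- Beyond `i` it lies inside, and `¬ P i` says that its place is wrong. For `i = n` nothing lies
    -- beyond, and `¬ Increasing n f` excludes the threshold `n` itself.
    truncate : ∀ {k q} {P} i r {P′} → State k q P f →
               0 < i → (i ≤ k × ¬ P i) ⊎ (i ≡ n × ¬ Increasing n f) →
               r ≤ q → r ≤ i → r ≡ q ⊎ r ≡ i →
               (∀ {m} → 0 < m → m ≤ r → P m → P′ m) →
               (∀ {j m} → 0 < m → m ≤ r → j ≤ m → P′ j → j ≡ m × P m) →
               State r r P′ (i ◂ f)
    truncate {k} {q} {P} i r s 0<i cut r≤q r≤i min to from = record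
      { ranking = ranking-◂ i≤n (ranking s)
      ; k<n     = s≤s (≤-trans r≤i i≤n)
      ; q≤k     = ≤-refl
      ; act     = λ m≤r → active-low⁺ (≤-trans m≤r r≤i)
                            (act s (≤-trans m≤r (≤-trans r≤q (q≤k s)))) (inc s (≤-trans m≤r r≤q))
      ; ¬act    = inactive
      ; inc     = λ m≤r → increasing-low⁺ (≤-trans m≤r r≤i) (inc s (≤-trans m≤r r≤q))
      ; ¬inc    = λ r<m m≤r → ⊥-elim (<⇒≱ r<m m≤r)
      ; split   = λ 0<m m≤r j≤m P′j → splits 0<m m≤r (from 0<m m≤r j≤m P′j)
      ; ¬split  = λ 0<m m≤r j≤m spl →
          let j≡m , spl′ = split-low⁻ (ranking s) (≤-trans m≤r r≤i) i≤n j≤m spl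
          in subst _ (sym j≡m)
               (to 0<m m≤r (¬split s 0<m (≤-trans m≤r (≤-trans r≤q (q≤k s))) ≤-refl spl′))
      }
      where
      i≤n : i ≤ n
      i≤n = [ (λ (i≤k , _) → ≤-trans i≤k (<⇒≤ (k<n s))) , (λ (i≡n , _) → ≤-reflexive i≡n) ] cut

      splits : ∀ {j m} → 0 < m → m ≤ r → j ≡ m × P m → Split j m (i ◂ f)
      splits 0<m m≤r (refl , Pm) =
        split-low⁺ (≤-trans m≤r r≤i) (split s 0<m (≤-trans m≤r (≤-trans r≤q (q≤k s))) ≤-refl Pm)

      beyond : ∀ {m} → q < m → m ≤ i → Active m f → ¬ Increasing m f
      beyond {m} q<m m≤i am im with m ≤? k
      ... | yes m≤k = ¬inc s q<m m≤k im
      ... | no  m≰k = [ (λ (i≤k , _) → m≰k (≤-trans m≤i i≤k)) ,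
                        (λ (i≡n , ¬id) → [ (λ m<n → ¬act s (≰⇒> m≰k) m<n am) ,
                                           (λ m≡n → ¬id (subst (λ m → Increasing m f) m≡n im)) ]
                                         (m≤n⇒m<n∨m≡n (≤-trans m≤i (≤-reflexive i≡n)))) ] cut

      inactive : ∀ {m} → r < m → m < suc n → ¬ Active m (i ◂ f)
      inactive {m} r<m m≤n a with m ≤? i
      inactive r<m m≤n a | yes m≤i =
        [ (λ r≡q → let am , im = active-low⁻ m≤i a in beyond (subst (_< _) r≡q r<m) m≤i am im) ,
          (λ r≡i → <⇒≱ r<m (≤-trans m≤i (≤-reflexive (sym r≡i)))) ] min
      inactive {suc m} r<m m<n a | no m≰i =
        [ (λ (i≤k , ¬Pi) → past ¬Pi) ,
          (λ (i≡n , _) → m≰i (≤-trans (s≤s⁻¹ m<n) (≤-reflexive (sym i≡n)))) ] cut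
        where
        i≤m = s≤s⁻¹ (≰⇒> m≰i)
        past : ¬ P i → ⊥
        past ¬Pi with m ≤? k
        ... | yes m≤k = ¬Pi (¬split s (<-≤-trans 0<i i≤m) m≤k i≤m (proj₂ (active-high⁻ i≤m a)))
        ... | no  m≰k = ¬act s (≰⇒> m≰k) (s<s⁻¹ m<n) (proj₁ (active-high⁻ i≤m a))

  -- The word is 0 1 ... k, the one case in which prepending rank `n` does not truncate: the result
  -- k+1 0 1 ... k is still a cyclic rotation of an increasing word, with its first `suc k` letters
  -- all at the end.
  rotate : ∀ {k} {f : Fin (suc k) → ℕ} → State k k (_≡ 0) f → Increasing (suc k) f →
           State (suc k) (suc k) (_≡ suc k) (suc k ◂ f)
  rotate {k} {f} s i = record
    { ranking = ranking-◂ ≤-refl rk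
    ; k<n     = ≤-refl
    ; q≤k     = ≤-refl
    ; act     = active′
    ; ¬act    = λ k<m m≤k → ⊥-elim (<⇒≱ k<m (s≤s⁻¹ m≤k))
    ; inc     = λ m≤k → increasing-low⁺ m≤k (increasing′ m≤k)
    ; ¬inc    = λ k<m m≤k → ⊥-elim (<⇒≱ k<m m≤k)
    ; split   = split′
    ; ¬split  = ¬split′
    }
    where
    rk = ranking s

    increasing′ : ∀ {m} → m ≤ suc k → Increasing m f
    increasing′ m≤k p<q (y<x , x<m) = i p<q (y<x , <-≤-trans x<m m≤k)

    active′ : ∀ {m} → m ≤ suc k → Active m (suc k ◂ f)
    active′ m≤k with m≤n⇒m<n∨m≡n m≤k
    ... | inj₁ m<k  = active-low⁺ m≤k (act s (s≤s⁻¹ m<k)) (increasing′ m≤k)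
    ... | inj₂ refl = active-low⁺ ≤-refl (active-top rk) i

    split′ : ∀ {j m} → 0 < m → m ≤ suc k → j ≤ m → j ≡ suc k → Split j m (suc k ◂ f)
    split′ _ m≤k j≤m refl with ≤-antisym m≤k j≤m
    ... | refl = split-low⁺ ≤-refl (split-top rk)

    ¬split′ : ∀ {j m} → 0 < m → m ≤ suc k → j ≤ m → Split j m (suc k ◂ f) → j ≡ suc k
    ¬split′ 0<m m≤k j≤m spl with split-low⁻ rk m≤k ≤-refl j≤m spl | m≤n⇒m<n∨m≡n m≤k
    ... | refl , spl′ | inj₁ m<k  = contradiction (¬split s 0<m (s≤s⁻¹ m<k) ≤-refl spl′) (>⇒≢ 0<m)
    ... | refl , _    | inj₂ refl = refl

  -- The labels and their children

  -- The cyclic run touches neither end of the word (A), starts at its front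
  -- (B), or has its first suc j letters at the end of the word and the other l
  -- at the front (C). D k is the word 0 1 … k. A run of all n letters, which
  -- occurs in C and D, is counted as having length n - 1.
  data Label : Set where
    A B D : ℕ → Label
    C     : ℕ → ℕ → Label

  -- Linear increase of the whole word is recorded because it decides between `rotate` and
  -- `truncate` when rank `n` is prepended.
  Has : Label → ∀ {n} → (Fin n → ℕ) → Set
  Has (A k)   {n} f = State k k (λ _ → ⊥) f × ¬ Increasing n f
  Has (B k)   {n} f = State k k (_≡ 0) f × ¬ Increasing n f
  Has (C j l) {n} f = State (suc j + l) (suc j) (_≡ suc j) f × ¬ Increasing n f
  Has (D k)   {n} f = State k k (_≡ 0) f × Increasing n f × n ≡ suc k

  around : ∀ {X : Set} → ℕ → X → X → (ℕ → X) → ℕ → X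
  around zero    x y g zero    = x
  around zero    x y g (suc i) = y
  around (suc j) x y g zero    = g 0
  around (suc j) x y g (suc i) = around j x y (g ∘ suc) i

  cons : ∀ {X : Set} → X → (ℕ → X) → ℕ → X
  cons x g zero    = x
  cons x g (suc i) = g i

  run : Label → ℕ
  run (A k)   = k
  run (B k)   = k
  run (C j l) = suc j + l
  run (D k)   = k

  child : Label → ℕ → Label
  child (A k)   = cons (B 1) (A ∘ suc)
  child (B k)   = cons (B (suc k)) (A ∘ suc)
  child (C j l) = around (suc j) (C j (suc l)) (C j 0) (cons (B 1) (A ∘ suc))
  child (D k)   = cons (D (suc k)) (A ∘ suc)

  last : Label → Label
  last (A k)   = A k
  last (B k)   = A k
  last (C j l) = C j 0
  last (D k)   = C k 0

  module _ {X : Set} {x y : X} where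

    around-< : ∀ {i j g} → i < j → around j x y g i ≡ g i
    around-< {zero}  {suc j} _ = refl
    around-< {suc i} {suc j} p = around-< (s<s⁻¹ p)

    around-≡ : ∀ {i g} → around i x y g i ≡ x
    around-≡ {zero}  = refl
    around-≡ {suc i} = around-≡ {i}

    around-> : ∀ {i j g} → j < i → around j x y g i ≡ y
    around-> {suc i} {zero}  _ = refl
    around-> {suc i} {suc j} p = around-> (s<s⁻¹ p)

  module _ {n} {f : Fin n → ℕ} where

    ¬increasing-tail : ∀ {i} → i ≤ n → ¬ Increasing n f → ¬ Increasing (suc n) (i ◂ f)
    ¬increasing-tail i≤n ¬id = ¬id ∘ increasing-high⁻ i≤n

    ¬increasing-pos : ∀ {i} → Ranking f → 0 < i → i ≤ n → ¬ Increasing (suc n) (i ◂ f)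
    ¬increasing-pos rk 0<i i≤n inc′ = >⇒≢ 0<i (increasing-high rk i≤n i≤n inc′)

    toA : ∀ {k q P} i → State k q P f → 0 < i → i ≤ q → (∀ {m} → 0 < m → m ≤ i → ¬ P m) →
          Has (A i) (i ◂ f)
    toA i s 0<i i≤q ¬P =
      truncate i i s 0<i (inj₁ (i≤k , ¬P 0<i ≤-refl)) i≤q ≤-refl (inj₂ refl)
        (λ 0<m m≤i → ¬P 0<m m≤i) (λ _ _ _ ()) ,
      ¬increasing-pos (ranking s) 0<i (≤-trans i≤k (<⇒≤ (k<n s)))
      where i≤k = ≤-trans i≤q (q≤k s)

    toC : ∀ {j l} i → State (suc j + l) (suc j) (_≡ suc j) f → suc j ≤ i →
          (i ≤ suc j + l × i ≢ suc j) ⊎ (i ≡ n × ¬ Increasing n f) → i ≤ n →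
          Has (C j 0) (i ◂ f)
    toC {j} i s j<i cut i≤n =
      subst (λ k → State k (suc j) (_≡ suc j) (i ◂ f)) (sym (+-identityʳ (suc j)))
        (truncate i (suc j) s (<-≤-trans z<s j<i) cut ≤-refl j<i (inj₁ refl)
          (λ _ _ → id) (λ { _ m≤j j≤m refl → ≤-antisym j≤m m≤j , ≤-antisym m≤j j≤m })) ,
      ¬increasing-pos (ranking s) (<-≤-trans z<s j<i) i≤n

    child-has : ∀ ℓ i → i ≤ run ℓ → Has ℓ f → Has (child ℓ i) (i ◂ f)
    child-has (A k) zero    _   (s , ¬id) = restart s (λ ()) , ¬increasing-tail z≤n ¬id
    child-has (A k) (suc i) i≤k (s , _)   = toA (suc i) s z<s i≤k (λ _ _ ())
    child-has (B k) zero    _   (s , ¬id) = extend-front s , ¬increasing-tail z≤n ¬id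
    child-has (B k) (suc i) i≤k (s , _)   = toA (suc i) s z<s i≤k (λ { () _ refl })
    child-has (D k) zero    _   (s , id , refl) = extend-front s , increasing-zero⁺ id , refl
    child-has (D k) (suc i) i≤k (s , _)   = toA (suc i) s z<s i≤k (λ { () _ refl })
    child-has (C j l) zero _ (s , ¬id) = restart s (λ ()) , ¬increasing-tail z≤n ¬id
    child-has (C j l) (suc i) i≤k (s , ¬id) with <-cmp i j
    ... | tri< i<j _ _ = subst (λ ℓ → Has ℓ (suc i ◂ f)) (sym (around-< i<j))
                           (toA (suc i) s z<s (<⇒≤ (s<s i<j)) λ { _ m≤i refl → <⇒≱ (s<s i<j) m≤i })
    ... | tri> _ i≢j j<i = subst (λ ℓ → Has ℓ (suc i ◂ f)) (sym (around-> j<i))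
                           (toC (suc i) s (<⇒≤ (s<s j<i)) (inj₁ (i≤k , i≢j ∘ suc-injective))
                             (≤-trans i≤k (<⇒≤ (k<n s))))
    ... | tri≈ _ refl _ = subst (λ ℓ → Has ℓ (suc i ◂ f)) (sym (around-≡ {i = i}))
                           (subst (λ k → State k (suc i) (_≡ suc i) (suc i ◂ f)) (sym (+-suc (suc i) l))
                             (extend-back z<s s) ,
                            ¬increasing-pos (ranking s) z<s (≤-trans i≤k (<⇒≤ (k<n s))))

    last-has : ∀ ℓ → Has ℓ f → Has (last ℓ) (n ◂ f)
    last-has (A k) (s , ¬id) = truncate n k s 0<n (inj₂ (refl , ¬id)) ≤-refl (<⇒≤ (k<n s)) (inj₁ refl)
        (λ _ _ ()) (λ _ _ _ ()) , ¬increasing-pos (ranking s) 0<n ≤-refl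
      where 0<n = ≤-<-trans z≤n (k<n s)
    last-has (B k) (s , ¬id) = truncate n k s 0<n (inj₂ (refl , ¬id)) ≤-refl (<⇒≤ (k<n s)) (inj₁ refl)
        (λ { () _ refl }) (λ _ _ _ ()) , ¬increasing-pos (ranking s) 0<n ≤-refl
      where 0<n = ≤-<-trans z≤n (k<n s)
    last-has (C j l) (s , ¬id) =
      toC n s (≤-trans (q≤k s) (<⇒≤ (k<n s))) (inj₂ (refl , ¬id)) ≤-refl
    last-has (D k) (s , id , refl) =
      subst (λ k′ → State k′ (suc k) (_≡ suc k) (suc k ◂ f)) (sym (+-identityʳ (suc k))) (rotate s id) ,
      ¬increasing-pos (ranking s) z<s ≤-refl

  -- Pattern avoidance in terms of ranks

  T : List Pattern
  T = (2 ∷ 1 ∷ 3 ∷ 4 ∷ []) ∷ (2 ∷ 3 ∷ 4 ∷ 1 ∷ []) ∷ (2 ∷ 4 ∷ 1 ∷ 3 ∷ []) ∷ []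

  -- A strictly increasing map on all of ℕ that sends the pattern letters 1, 2, 3, 4 to the
  -- successors of the chosen letters. The successor leaves room for the value at 0, since `s₁` may
  -- be 0.
  embed : (s₁ s₂ s₃ s₄ : ℕ) → ℕ → ℕ
  embed s₁ s₂ s₃ s₄ 0                         = 0
  embed s₁ s₂ s₃ s₄ 1                         = suc s₁
  embed s₁ s₂ s₃ s₄ 2                         = suc s₂
  embed s₁ s₂ s₃ s₄ 3                         = suc s₃
  embed s₁ s₂ s₃ s₄ (suc (suc (suc (suc i)))) = suc (i + s₄)

  orderIsomorphic : ∀ {s₁ s₂ s₃ s₄ k} (u v : Vec ℕ k) → s₁ < s₂ → s₂ < s₃ → s₃ < s₄ →
                    (∀ a → suc (lookup u a) ≡ embed s₁ s₂ s₃ s₄ (lookup v a)) → OrderIsomorphic u v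
  orderIsomorphic {s₁} {s₂} {s₃} {s₄} u v s₁<s₂ s₂<s₃ s₃<s₄ eq a b = mk⇔ to from
    where
    φ = embed s₁ s₂ s₃ s₄

    φ-step : ∀ x → φ x < φ (suc x)
    φ-step 0 = z<s
    φ-step 1 = s<s s₁<s₂
    φ-step 2 = s<s s₂<s₃
    φ-step 3 = s<s s₃<s₄
    φ-step (suc (suc (suc (suc i)))) = ≤-refl

    φ-mono : ∀ {x y} → x < y → φ x < φ y
    φ-mono {x} {suc y} x≤y with m≤n⇒m<n∨m≡n (s≤s⁻¹ x≤y)
    ... | inj₁ x<y  = <-trans (φ-mono x<y) (φ-step y)
    ... | inj₂ refl = φ-step y

    from : ∀ {a b} → lookup v a < lookup v b → lookup u a < lookup u b
    from {a} {b} p = s<s⁻¹ (subst₂ _<_ (sym (eq a)) (sym (eq b)) (φ-mono p))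

    to : lookup u a < lookup u b → lookup v a < lookup v b
    to p with <-cmp (lookup v a) (lookup v b)
    ... | tri< q _ _ = q
    ... | tri> _ _ q = contradiction (from q) (<-asym p)
    ... | tri≈ _ q _ =
      contradiction (suc-injective (trans (eq a) (trans (cong φ q) (sym (eq b))))) (<⇒≢ p)

  opposite-anti-< : ∀ {n} {i j : Fin n} → i Fin.< j → opposite j Fin.< opposite i
  opposite-anti-< {suc n} {i} {j} i<j =
    subst₂ _<_ (sym (Fin.opposite-prop j)) (sym (Fin.opposite-prop i)) (∸-monoʳ-< i<j (Fin.toℕ≤pred[n] j))

  opposite-cancel-< : ∀ {n} {i j : Fin n} → opposite j Fin.< opposite i → i Fin.< j
  opposite-cancel-< {i = i} {j} p =
    subst₂ Fin._<_ (Fin.opposite-involutive i) (Fin.opposite-involutive j) (opposite-anti-< p)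

  -- The rank of a letter is the number of greater letters.
  ranks : ∀ {n k} → Vec (Fin n) k → Fin k → ℕ
  ranks π p = toℕ (opposite (lookup π p))

  Avoids⇒ : ∀ {n} {π : Vec (Fin n) n} → π avoids T → Avoiding (ranks π)
  Avoids⇒ {π = π} (¬2134 List.∷ ¬2341 List.∷ ¬2413 List.∷ List.[]) {o} {p} {q} {r} o<p p<q q<r = λ where
      (inj₁ (z<y , y<o , o<x)) → ¬2134 (places , sorted , orderIsomorphic letters (2 ∷ 1 ∷ 3 ∷ 4 ∷ [])
        (opposite-cancel-< o<x) (opposite-cancel-< y<o) (opposite-cancel-< z<y)
        λ { 0F → refl ; 1F → refl ; 2F → refl ; 3F → refl })
      (inj₂ (inj₁ (y<x , x<o , o<z))) → ¬2341 (places , sorted , orderIsomorphic letters (2 ∷ 3 ∷ 4 ∷ 1 ∷ [])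
        (opposite-cancel-< o<z) (opposite-cancel-< x<o) (opposite-cancel-< y<x)
        λ { 0F → refl ; 1F → refl ; 2F → refl ; 3F → refl })
      (inj₂ (inj₂ (x<z , z<o , o<y))) → ¬2413 (places , sorted , orderIsomorphic letters (2 ∷ 4 ∷ 1 ∷ 3 ∷ [])
        (opposite-cancel-< o<y) (opposite-cancel-< z<o) (opposite-cancel-< x<z)
        λ { 0F → refl ; 1F → refl ; 2F → refl ; 3F → refl })
    where
    places = o ∷ p ∷ q ∷ r ∷ []
    letters = Vec.map (toℕ ∘ lookup π) places
    sorted : AllPairs Fin._<_ places
    sorted = (o<p ∷ <-trans o<p p<q ∷ <-trans o<p (<-trans p<q q<r) ∷ [])
           ∷ (p<q ∷ <-trans p<q q<r ∷ []) ∷ (q<r ∷ []) ∷ [] ∷ []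

  ⇒Avoids : ∀ {n} {π : Vec (Fin n) n} → Avoiding (ranks π) → π avoids T
  ⇒Avoids {π = π} av = ¬2134 List.∷ ¬2341 List.∷ ¬2413 List.∷ List.[]
    where
    ¬2134 : ¬ π contains _
    ¬2134 (o ∷ p ∷ q ∷ r ∷ [] , (o<p ∷ _) ∷ (p<q ∷ _) ∷ (q<r ∷ _) ∷ _ , iso) = av o<p p<q q<r
      (inj₁ (opposite-anti-< (Equivalence.from (iso 2F 3F) ≤-refl) ,
             opposite-anti-< (Equivalence.from (iso 0F 2F) ≤-refl) ,
             opposite-anti-< (Equivalence.from (iso 1F 0F) ≤-refl)))
    ¬2341 : ¬ π contains _
    ¬2341 (o ∷ p ∷ q ∷ r ∷ [] , (o<p ∷ _) ∷ (p<q ∷ _) ∷ (q<r ∷ _) ∷ _ , iso) = av o<p p<q q<r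
      (inj₂ (inj₁ (opposite-anti-< (Equivalence.from (iso 1F 2F) ≤-refl) ,
             opposite-anti-< (Equivalence.from (iso 0F 1F) ≤-refl) ,
             opposite-anti-< (Equivalence.from (iso 3F 0F) ≤-refl))))
    ¬2413 : ¬ π contains _
    ¬2413 (o ∷ p ∷ q ∷ r ∷ [] , (o<p ∷ _) ∷ (p<q ∷ _) ∷ (q<r ∷ _) ∷ _ , iso) = av o<p p<q q<r
      (inj₂ (inj₂ (opposite-anti-< (Equivalence.from (iso 3F 1F) ≤-refl) ,
             opposite-anti-< (Equivalence.from (iso 0F 3F) ≤-refl) ,
             opposite-anti-< (Equivalence.from (iso 2F 0F) ≤-refl))))

  avoiding-resp : ∀ {n} {f g : Fin n → ℕ} → f ≗ g → Avoiding f → Avoiding g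
  avoiding-resp e av {o} {p} {q} {r} o<p p<q q<r bad
    rewrite sym (e o) | sym (e p) | sym (e q) | sym (e r) = av o<p p<q q<r bad

  -- Generating the avoiders by prepending

  prepend : ∀ {n} → Vec (Fin n) n → Fin (suc n) → Vec (Fin (suc n)) (suc n)
  prepend π i = opposite i ∷ Vec.map (punchIn (opposite i)) π

  opposite-punchIn : ∀ {n} (v : Fin (suc n)) (x : Fin n) →
                     toℕ (opposite (punchIn v x)) ≡ bump (toℕ (opposite v)) (toℕ (opposite x))
  opposite-punchIn {suc n} zero x = begin
    toℕ (Fin.inject₁ (opposite x))                 ≡⟨ Fin.toℕ-inject₁ (opposite x) ⟩
    toℕ (opposite x)                               ≡⟨ bump-below (Fin.toℕ<n (opposite x)) ⟨
    bump (suc n) (toℕ (opposite x))                ≡⟨ cong (λ i → bump i (toℕ (opposite x))) (Fin.toℕ-fromℕ (suc n)) ⟨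
    bump (toℕ (fromℕ (suc n))) (toℕ (opposite x))  ∎
    where open ≡-Reasoning
  opposite-punchIn {suc n} (suc v) zero
    rewrite Fin.toℕ-inject₁ (opposite v) | Fin.toℕ-fromℕ n =
    sym (bump-above (Fin.toℕ≤pred[n] (opposite v)))
  opposite-punchIn {suc n} (suc v) (suc x)
    rewrite Fin.toℕ-inject₁ (opposite v) | Fin.toℕ-inject₁ (opposite x)
          | Fin.toℕ-inject₁ (opposite (punchIn v x)) = opposite-punchIn v x

  ranks-prepend : ∀ {n} {π : Vec (Fin n) n} {f} → ranks π ≗ f → ∀ i → ranks (prepend π i) ≗ toℕ i ◂ f
  ranks-prepend e i zero = cong toℕ (Fin.opposite-involutive i)
  ranks-prepend {π = π} {f} e i (suc p) = begin
    toℕ (opposite (lookup (Vec.map (punchIn v) π) p))  ≡⟨ cong (toℕ ∘ opposite) (lookup-map p (punchIn v) π) ⟩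
    toℕ (opposite (punchIn v (lookup π p)))            ≡⟨ opposite-punchIn v (lookup π p) ⟩
    bump (toℕ (opposite v)) (ranks π p)                ≡⟨ cong₂ bump (cong toℕ (Fin.opposite-involutive i)) (e p) ⟩
    bump (toℕ i) (f p)                                 ∎
    where
    open ≡-Reasoning
    v = opposite i

  prepend-injective : ∀ {n} {π ρ : Vec (Fin n) n} {i j} → prepend π i ≡ prepend ρ j → π ≡ ρ × i ≡ j
  prepend-injective {i = i} {j} eq with ∷-injective eq
  ... | i≡j , eq′ with trans (sym (Fin.opposite-involutive i)) (trans (cong opposite i≡j) (Fin.opposite-involutive j))
  ...   | refl = map-injective eq′ , refl
    where
    map-injective : ∀ {m k} {v : Fin (suc m)} {xs ys : Vec (Fin m) k} →
                    Vec.map (punchIn v) xs ≡ Vec.map (punchIn v) ys → xs ≡ ys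
    map-injective {xs = []}     {[]}     _  = refl
    map-injective {v = v} {x ∷ xs} {y ∷ ys} eq =
      let e , es = ∷-injective eq in cong₂ _∷_ (Fin.punchIn-injective v x y e) (map-injective es)

  grow : ∀ n → List (Vec (Fin n) n)
  grow zero    = [] ∷ []
  grow (suc n) = filter (_avoids? T) (cartesianProductWith prepend (grow n) (allFin (suc n)))

  grow-unique : ∀ n → List.Unique (grow n)
  grow-unique zero    = List.[] ListAllPairs.∷ ListAllPairs.[]
  grow-unique (suc n) = ListUnique.filter⁺ (_avoids? T)
    (ListUnique.cartesianProductWith⁺ prepend prepend-injective (grow-unique n) (ListUnique.allFin⁺ (suc n)))

  grow-permutation : ∀ {n} {π : Vec (Fin n) n} → π ∈ grow n → IsPermutation π
  grow-permutation {zero} (here refl) = []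
  grow-permutation {suc n} π∈ =
    prepended (∈-cartesianProductWith⁻ prepend (grow n) (allFin (suc n)) (proj₁ (∈-filter⁻ (_avoids? T) π∈)))
    where
    prepended : ∀ {π} → ∃[ ρ ] ∃[ i ] ρ ∈ grow n × i ∈ allFin (suc n) × π ≡ prepend ρ i → IsPermutation π
    prepended (ρ , i , ρ∈ , _ , refl) =
      VecAll.map⁺ (VecAll.universal (λ x → Fin.punchInᵢ≢i (opposite i) x ∘ sym) ρ) ∷
      VecUnique.map⁺ (Fin.punchIn-injective (opposite i) _ _) (grow-permutation ρ∈)

  grow-avoids : ∀ {n} {π : Vec (Fin n) n} → π ∈ grow n → π avoids T
  grow-avoids {zero} {[]} _ = ⇒Avoids {π = []} λ { {()} }
  grow-avoids {suc n} π∈ =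
    proj₂ (∈-filter⁻ (_avoids? T) {xs = cartesianProductWith prepend (grow n) (allFin (suc n))} π∈)

  unprepend : ∀ {n v} {π : Vec (Fin (suc n)) n} → All (v ≢_) π → ∃[ ρ ] ∃[ i ] prepend ρ i ≡ v ∷ π
  unprepend {n} {v} v≢ =
    let ρ , e = punchOuts v≢
    in ρ , opposite v , trans (cong (λ v → v ∷ Vec.map (punchIn v) ρ) (Fin.opposite-involutive v)) (cong (v ∷_) e)
    where
    punchOuts : ∀ {k} {xs : Vec (Fin (suc n)) k} → All (v ≢_) xs → ∃[ ys ] Vec.map (punchIn v) ys ≡ xs
    punchOuts []        = [] , refl
    punchOuts (v≢ ∷ vs) = let ys , e = punchOuts vs
                          in punchOut v≢ ∷ ys , cong₂ _∷_ (Fin.punchIn-punchOut v≢) e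

  unique-map⁻ : ∀ {m n k} {f : Fin m → Fin n} {xs : Vec (Fin m) k} → Unique (Vec.map f xs) → Unique xs
  unique-map⁻ {xs = []}     []       = []
  unique-map⁻ {f = f} {xs = x ∷ xs} (x≢ ∷ u) =
    VecAll.map (λ fx≢ → fx≢ ∘ cong f) (VecAll.map⁻ x≢) ∷ unique-map⁻ u

  -- Deleting the first letter preserves avoidance, so filtering at every length loses no avoider.
  grow-complete : ∀ {n} {π : Vec (Fin n) n} → IsPermutation π → π avoids T → π ∈ grow n
  grow-complete {zero} {[]} _ _ = here refl
  grow-complete {suc n} {v ∷ π} perm@(v≢ ∷ _) av =
    let ρ , i , e = unprepend v≢
    in subst (_∈ grow (suc n)) e (extend ρ i (subst IsPermutation (sym e) perm) (subst (_avoids T) (sym e) av))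
    where
    extend : ∀ ρ i → IsPermutation (prepend ρ i) → prepend ρ i avoids T → prepend ρ i ∈ grow (suc n)
    extend ρ i (_ ∷ u) av = ∈-filter⁺ (_avoids? T)
      {xs = cartesianProductWith prepend (grow n) (allFin (suc n))}
      (∈-cartesianProductWith⁺ prepend (grow-complete (unique-map⁻ u) ρ-avoids) (∈-allFin i)) av
      where
      ρ-avoids : ρ avoids T
      ρ-avoids = ⇒Avoids {π = ρ} (proj₂ (◂-avoiding {f = ranks ρ}
        (avoiding-resp (ranks-prepend {π = ρ} (λ _ → refl) i) (Avoids⇒ {π = prepend ρ i} av))))

  module _ {n : ℕ} {T : List Pattern} where

    private
      P? : Decidable {A = Vec (Fin n) n} (λ π → IsPermutation π × π avoids T)
      P? π = isPermutation? π ×-dec π avoids? T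

    S-unique : List.Unique (S n T)
    S-unique = ListUnique.filter⁺ P? (words-unique n n)

    ∈-S⁺ : ∀ {π} → IsPermutation π → π avoids T → π ∈ S n T
    ∈-S⁺ u av = ∈-filter⁺ P? (words-complete _) (u , av)

    ∈-S⁻ : ∀ {π} → π ∈ S n T → IsPermutation π × π avoids T
    ∈-S⁻ π∈ = proj₂ (∈-filter⁻ P? {xs = words n n} π∈)

  length-unique : ∀ {A : Set} {xs ys : List A} → List.Unique xs → List.Unique ys →
                  (∀ {x} → x ∈ xs → x ∈ ys) → (∀ {x} → x ∈ ys → x ∈ xs) → length xs ≡ length ys
  length-unique u v xs⊆ys ys⊆xs = ↭-length (∼bag⇒↭ (unique∧set⇒bag u v (mk⇔ xs⊆ys ys⊆xs)))

  length-S : ∀ n → length (S n T) ≡ length (grow n)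
  length-S n = length-unique (S-unique {n} {T}) (grow-unique n)
    (λ {π} π∈ → grow-complete (proj₁ (∈-S⁻ {n} {T} π∈)) (proj₂ (∈-S⁻ {n} {T} π∈)))
    (λ {π} π∈ → ∈-S⁺ {n} {T} (grow-permutation π∈) (grow-avoids π∈))

  -- Counting descendants by labels

  kids : ∀ {n} → Vec (Fin n) n → List (Vec (Fin (suc n)) (suc n))
  kids π = filter (_avoids? T) (map (prepend π) (allFin _))

  descendants : ∀ {n} → ℕ → Vec (Fin n) n → ℕ
  descendants zero    π = 1
  descendants (suc m) π = sum (map (descendants m) (kids π))

  -- Trades one level of the list for one more generation of descendants; `length-grow` iterates
  -- this down to the empty word.
  sum-grow : ∀ m n → sum (map (descendants m) (grow (suc n))) ≡ sum (map (descendants (suc m)) (grow n))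
  sum-grow m n = go (grow n)
    where
    open ≡-Reasoning
    g : List (Vec (Fin (suc n)) (suc n)) → ℕ
    g = sum ∘ map (descendants m)
    go : ∀ πs → g (filter (_avoids? T) (cartesianProductWith prepend πs (allFin (suc n)))) ≡
                sum (map (descendants (suc m)) πs)
    go []       = refl
    go (π ∷ πs) = begin
      g (filter (_avoids? T) (map (prepend π) (allFin (suc n)) ++ rest))
        ≡⟨ cong g (List.filter-++ (_avoids? T) (map (prepend π) (allFin (suc n))) rest) ⟩
      g (kids π ++ filter (_avoids? T) rest)
        ≡⟨ cong sum (List.map-++ (descendants m) (kids π) _) ⟩
      sum (map (descendants m) (kids π) ++ map (descendants m) (filter (_avoids? T) rest))
        ≡⟨ sum-++ (map (descendants m) (kids π)) _ ⟩
      g (kids π) + g (filter (_avoids? T) rest)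
        ≡⟨ cong (g (kids π) +_) (go πs) ⟩
      g (kids π) + sum (map (descendants (suc m)) πs)
        ∎
      where rest = cartesianProductWith prepend πs (allFin (suc n))

  length-grow : ∀ n → length (grow n) ≡ descendants n []
  length-grow n =
    trans (length-sum (grow n)) (trans (go 0 n)
      (trans (+-identityʳ _) (cong (λ m → descendants m []) (+-identityʳ n))))
    where
    length-sum : ∀ {A : Set} (xs : List A) → length xs ≡ sum (map (λ _ → 1) xs)
    length-sum []       = refl
    length-sum (x ∷ xs) = cong suc (length-sum xs)
    go : ∀ m n → sum (map (descendants m) (grow n)) ≡ sum (map (descendants (n + m)) (grow 0))
    go m zero    = refl
    go m (suc n) = trans (sum-grow m n) (trans (go (suc m) n)
                     (cong (λ k → sum (map (descendants k) (grow 0))) (+-suc n m)))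

  Σ≤ : (ℕ → ℕ) → ℕ → ℕ
  Σ≤ u zero    = u 0
  Σ≤ u (suc k) = u 0 + Σ≤ (u ∘ suc) k

  module _ {A : Set} {P : A → Set} (P? : Decidable P) (g : A → ℕ) where

    sum-last : ∀ {n l} {h : Fin (suc n) → A} →
               (∀ i → toℕ i < n → ¬ P (h i)) → (∀ i → toℕ i ≡ n → P (h i) × g (h i) ≡ l) →
               sum (map g (filter P? (tabulate h))) ≡ l
    sum-last {zero} rej acc with acc 0F refl
    ... | Ph , refl rewrite List.filter-accept P? {xs = []} Ph = +-identityʳ _
    sum-last {suc n} {h = h} rej acc rewrite List.filter-reject P? {xs = tabulate (h ∘ suc)} (rej 0F z<s) =
      sum-last (λ i → rej (suc i) ∘ s<s) (λ i → acc (suc i) ∘ cong suc)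

    sum-run : ∀ {n k l u} {h : Fin (suc n) → A} → k < n →
              (∀ i → toℕ i ≤ k → P (h i) × g (h i) ≡ u (toℕ i)) →
              (∀ i → k < toℕ i → toℕ i < n → ¬ P (h i)) →
              (∀ i → toℕ i ≡ n → P (h i) × g (h i) ≡ l) →
              sum (map g (filter P? (tabulate h))) ≡ Σ≤ u k + l
    sum-run {suc n} {zero} {h = h} _ run rej acc with run 0F z≤n
    ... | Ph , eq rewrite List.filter-accept P? {xs = tabulate (h ∘ suc)} Ph =
      cong₂ _+_ eq (sum-last (λ i → rej (suc i) z<s ∘ s<s) (λ i → acc (suc i) ∘ cong suc))
    sum-run {suc n} {suc k} {l} {u} {h = h} k<n run rej acc with run 0F z≤n
    ... | Ph , eq rewrite List.filter-accept P? {xs = tabulate (h ∘ suc)} Ph =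
      trans (cong₂ _+_ eq (sum-run {u = u ∘ suc} (s<s⁻¹ k<n) (λ i → run (suc i) ∘ s≤s)
                             (λ i p q → rej (suc i) (s<s p) (s<s q)) (λ i → acc (suc i) ∘ cong suc)))
            (sym (+-assoc (u 0) _ l))

  count : Label → ℕ → ℕ
  count ℓ zero    = 1
  count ℓ (suc m) = Σ≤ (λ i → count (child ℓ i) m) (run ℓ) + count (last ℓ) m

  has⇒state : ∀ ℓ {n} {f : Fin n → ℕ} → Has ℓ f → ∃[ q ] ∃[ P ] State (run ℓ) q P f
  has⇒state (A k)   (s , _) = _ , _ , s
  has⇒state (B k)   (s , _) = _ , _ , s
  has⇒state (C j l) (s , _) = _ , _ , s
  has⇒state (D k)   (s , _) = _ , _ , s

  -- The ranks are known only pointwise as `f`, so that labels can follow `i ◂ f` without function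
  -- extensionality.
  descendants-count : ∀ m ℓ {n} {π : Vec (Fin n) n} {f} → ranks π ≗ f → Avoiding f → Has ℓ f →
                      descendants m π ≡ count ℓ m
  descendants-count zero ℓ _ _ _ = refl
  descendants-count (suc m) ℓ {n} {π} {f} e av has = begin
    sum (map (descendants m) (filter (_avoids? T) (map (prepend π) (allFin (suc n)))))
      ≡⟨ cong (sum ∘ map (descendants m) ∘ filter (_avoids? T)) (List.map-tabulate id (prepend π)) ⟩
    sum (map (descendants m) (filter (_avoids? T) (tabulate (prepend π))))
      ≡⟨ sum-run (_avoids? T) (descendants m) (k<n s)
           (λ i i≤k → extend (act s i≤k) (child-has ℓ (toℕ i) i≤k has))
           (λ i k<i i<n av′ → ¬act s k<i i<n
             (proj₁ (◂-avoiding (avoiding-resp (ranks-prepend e i) (Avoids⇒ {π = prepend π i} av′)))))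
           (λ { i i≡n → extend (subst (λ m → Active m f) (sym i≡n) (active-top (ranking s)))
                               (subst (λ m → Has (last ℓ) (m ◂ f)) (sym i≡n) (last-has ℓ has)) }) ⟩
    count ℓ (suc m) ∎
    where
    open ≡-Reasoning
    s = proj₂ (proj₂ (has⇒state ℓ has))
    extend : ∀ {i ℓ′} → Active (toℕ i) f → Has ℓ′ (toℕ i ◂ f) →
             prepend π i avoids T × descendants m (prepend π i) ≡ count ℓ′ m
    extend {i} {ℓ′} a has′ =
      let av′ = avoiding-◂ a av ; e′ = ranks-prepend e i
      in ⇒Avoids {π = prepend π i} (avoiding-resp (λ p → sym (e′ p)) av′) , descendants-count m ℓ′ e′ av′ has′

  -- Since `State` demands `k < n`, the empty word has no label and the labelled tree is rooted
  -- here.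
  singleton-has : Has (D 0) {1} (λ _ → 0)
  singleton-has = record
    { ranking = record { bounded = λ _ → z<s ; onto = λ { {zero} _ → zero , refl ; {suc x} (s≤s ()) } }
    ; k<n     = z<s
    ; q≤k     = z≤n
    ; act     = λ { {zero} _ {p} {q} {r} → active-zero {f = λ _ → 0} {p} {q} {r} }
    ; ¬act    = λ 0<m m<1 → ⊥-elim (<⇒≱ 0<m (s≤s⁻¹ m<1))
    ; inc     = λ { _ {zero} {zero} () }
    ; ¬inc    = λ 0<m m≤0 → ⊥-elim (<⇒≱ 0<m m≤0)
    ; split   = λ 0<m m≤0 → ⊥-elim (<⇒≱ 0<m m≤0)
    ; ¬split  = λ 0<m m≤0 → ⊥-elim (<⇒≱ 0<m m≤0)
    } , (λ { {zero} {zero} () }) , refl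

  length-S-suc : ∀ n → length (S (suc n) T) ≡ count (D 0) n
  length-S-suc n = trans (length-S (suc n)) (trans (length-grow (suc n))
    (sum-last (_avoids? T) (descendants n) {h = prepend []} (λ _ ())
      λ { 0F _ → ⇒Avoids {π = 0F ∷ []} (λ { {zero} {zero} () }) ,
                 descendants-count n (D 0) {π = 0F ∷ []} {f = λ _ → 0}
                   (λ { 0F → refl }) (λ { {zero} {zero} () }) singleton-has }))

open Tree
open import Data.Integer as ℤ using (ℤ; +_; -_; 0ℤ; 1ℤ; _+_; _-_; _*_)

-- Recurrences for the label counts

Σ≤-suc : ∀ u k → Σ≤ u (suc k) ≡ Σ≤ u k ℕ.+ u (suc k)
Σ≤-suc u zero    = refl
Σ≤-suc u (suc k) = trans (cong (u 0 ℕ.+_) (Σ≤-suc (u ∘ suc) k)) (sym (ℕ.+-assoc (u 0) _ _))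

module _ {X : Set} (h : X → ℕ) {x y : X} where

  Σ≤-cons : ∀ {g} k → Σ≤ (h ∘ cons x g) k ℕ.+ h y ≡ h x ℕ.+ Σ≤ (h ∘ cons y g) k
  Σ≤-cons zero    = refl
  Σ≤-cons {g} (suc k) = trans (ℕ.+-assoc (h x) _ (h y)) (cong (h x ℕ.+_) (ℕ.+-comm (Σ≤ (h ∘ g) k) (h y)))

  Σ≤-around : ∀ {g} j l → Σ≤ (h ∘ around (suc j) x y g) (suc j ℕ.+ l) ≡ Σ≤ (h ∘ g) j ℕ.+ (h x ℕ.+ l ℕ.* h y)
  Σ≤-around {g} zero zero    = cong (h (g 0) ℕ.+_) (sym (ℕ.+-identityʳ (h x)))
  Σ≤-around {g} zero (suc l) = cong (λ z → h (g 0) ℕ.+ (h x ℕ.+ z)) (Σ≤-const l)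
    where
    Σ≤-const : ∀ l → Σ≤ (λ _ → h y) l ≡ suc l ℕ.* h y
    Σ≤-const zero    = sym (ℕ.+-identityʳ (h y))
    Σ≤-const (suc l) = cong (h y ℕ.+_) (Σ≤-const l)
  Σ≤-around {g} (suc j) l = trans (cong (h (g 0) ℕ.+_) (Σ≤-around j l)) (sym (ℕ.+-assoc (h (g 0)) _ _))

-- Integers allow recurrences to be subtracted. By definition `a k (suc m)` is `s k m + a k m` and
-- `s 0 m` is `b 1 m`; several of the ring identities below use these unfolded forms.
a b d s : ℕ → ℕ → ℤ
a k m = + count (A k) m
b k m = + count (B k) m
d k m = + count (D k) m
s k m = + Σ≤ (λ i → count (cons (B 1) (A ∘ suc) i) m) k

c : ℕ → ℕ → ℕ → ℤ
c j l m = + count (C j l) m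

β : ℕ → ℤ
β zero    = 0ℤ
β (suc m) = β m + b 1 m

e : ℕ → ℕ → ℤ
e j zero    = 0ℤ
e j (suc m) = e j m + c j 0 m

-- As generating functions in m, t k and y k are the sums over i of xⁱ times
-- a (k + i) and c (k + i) 0; this is how the chains b k, b (k + 1), … and
-- d k, d (k + 1), … are summed.
t : ℕ → ℕ → ℤ
t k m = b k m + β m

y : ℕ → ℕ → ℤ
y k zero    = 1ℤ
y k (suc m) = y (suc k) m + c k 0 (suc m)

-- Proof by linear combination: `_⊕_` and `_⊙_` assemble known equations into `l ≡ r`, and a ring
-- identity checks that `x - y` equals `l - r`.
modulo : ∀ {l r x y : ℤ} → l ≡ r → x + r ≡ y + l → x ≡ y
modulo {l} {x = x} {y} refl p = ∙-cancelʳ ℤ.+-0-abelianGroup l x y p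

infixl 6 _⊕_
_⊕_ : ∀ {l r l′ r′ : ℤ} → l ≡ r → l′ ≡ r′ → l + l′ ≡ r + r′
_⊕_ = cong₂ _+_

infixr 7 _⊙_
_⊙_ : ∀ {l r : ℤ} x → l ≡ r → x * l ≡ x * r
x ⊙ p = cong (x *_) p

s-suc : ∀ k m → s (suc k) m ≡ s k m + a (suc k) m
s-suc k m = cong +_ (Σ≤-suc (λ i → count (cons (B 1) (A ∘ suc) i) m) k)

b-suc : ∀ k m → b k (suc m) + b 1 m ≡ b (suc k) m + s k m + a k m
b-suc k m = modulo (cong +_ (Σ≤-cons (λ ℓ → count ℓ m) {B (suc k)} {B 1} {A ∘ suc} k))
                   (ring (+ Σ≤ _ k) (a k m) (b 1 m) (b (suc k) m) (s k m))
  where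
  ring : ∀ u a b₁ b s → u + a + b₁ + (b + s) ≡ b + s + a + (u + b₁)
  ring = solve-∀

d-suc : ∀ k m → d k (suc m) + b 1 m ≡ d (suc k) m + s k m + c k 0 m
d-suc k m = modulo (cong +_ (Σ≤-cons (λ ℓ → count ℓ m) {D (suc k)} {B 1} {A ∘ suc} k))
                   (ring (+ Σ≤ _ k) (c k 0 m) (b 1 m) (d (suc k) m) (s k m))
  where
  ring : ∀ u a b₁ b s → u + a + b₁ + (b + s) ≡ b + s + a + (u + b₁)
  ring = solve-∀

c-suc : ∀ j l m → c j l (suc m) ≡ s j m + (c j (suc l) m + + l * c j 0 m) + c j 0 m
c-suc j l m = cong (_+ c j 0 m) (trans
  (cong +_ (Σ≤-around (λ ℓ → count ℓ m) {C j (suc l)} {C j 0} {cons (B 1) (A ∘ suc)} j l))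
  (cong (λ z → s j m + (c j (suc l) m + z)) (ℤ.pos-* l (count (C j 0) m))))

-- Along the chain `C j l`, `C j (suc l)`, ... the `l` initial front letters account for `l`
-- additional children `C j 0` in every generation; `e j` adds up their descendants.
c-linear : ∀ m j l → c j l m ≡ c j 0 m + + l * e j m
c-linear zero    j l = ring (+ l)
  where
  ring : ∀ l → 1ℤ ≡ 1ℤ + l * 0ℤ
  ring = solve-∀
c-linear (suc m) j l = modulo
  (c-suc j l m ⊕ c-linear m j (suc l) ⊕ (- 1ℤ) ⊙ c-suc j 0 m ⊕ (- 1ℤ) ⊙ c-linear m j 1)
  (ring (+ l) (c j l (suc m)) (c j 0 (suc m)) (c j (suc l) m) (c j 1 m) (c j 0 m) (s j m) (e j m))
  where
  ring : ∀ l x x₀ z z₁ z₀ s e →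
    x + ((s + (z + l * z₀) + z₀) + (z₀ + (1ℤ + l) * e) + (- 1ℤ) * (s + (z₁ + + 0 * z₀) + z₀) + (- 1ℤ) * (z₀ + + 1 * e)) ≡
    (x₀ + l * (e + z₀)) + (x + z + (- 1ℤ) * x₀ + (- 1ℤ) * z₁)
  ring = solve-∀

-- By `c-linear`, `c j 0 (suc m)` is `s j m + 2 * c j 0 m + e j m`. Differencing in `m` turns `e j`
-- into `c j 0`, and `s j` is itself a difference of `a j`.
c-rec : ∀ j m → c j 0 (2 ℕ.+ m) + c j 0 m + + 2 * a j (suc m) ≡
                + 3 * c j 0 (suc m) + a j (2 ℕ.+ m) + a j m
c-rec j m = modulo
  (c-suc j 0 (suc m) ⊕ c-linear (suc m) j 1 ⊕ (- 1ℤ) ⊙ (c-suc j 0 m ⊕ c-linear m j 1))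
  (ring (c j 0 (2 ℕ.+ m)) (c j 0 (suc m)) (c j 0 m) (c j 1 (suc m)) (c j 1 m) (s j (suc m)) (s j m) (a j m) (e j m))
  where
  ring : ∀ x₂ x₁ x₀ z₁ z₀ s₁ s₀ a₀ e →
    (x₂ + x₀ + + 2 * (s₀ + a₀)) +
      ((s₁ + (z₁ + + 0 * x₁) + x₁) + (x₁ + + 1 * (e + x₀)) + (- 1ℤ) * ((s₀ + (z₀ + + 0 * x₀) + x₀) + (x₀ + + 1 * e))) ≡
    (+ 3 * x₁ + (s₁ + (s₀ + a₀)) + a₀) + (x₂ + z₁ + (- 1ℤ) * (x₁ + z₀))
  ring = solve-∀

-- The stray term `b 1 m` in `b-suc` is the increment of `β`, which is why `t` includes `β`.
t-suc : ∀ k m → t k (suc m) ≡ t (suc k) m + a k (suc m)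
t-suc k m = modulo (b-suc k m) (ring (b k (suc m)) (b 1 m) (b (suc k) m) (s k m) (a k m) (β m))
  where
  ring : ∀ x b₁ z s a β → x + (β + b₁) + (z + s + a) ≡ z + β + (s + a) + (x + b₁)
  ring = solve-∀

a-rec : ∀ k m → a (suc k) (suc m) + a k m ≡ + 2 * a (suc k) m + a k (suc m)
a-rec k m = modulo (s-suc k m) (ring (s (suc k) m) (s k m) (a (suc k) m) (a k m))
  where
  ring : ∀ s₁ s₀ a₁ a₀ → s₁ + a₁ + a₀ + (s₀ + a₁) ≡ + 2 * a₁ + (s₀ + a₀) + s₁
  ring = solve-∀

-- The relation `a-rec` has coefficients independent of `k`, so it passes to the diagonal sums; only
-- the end of the diagonal, where `m = 0`, needs its own check.
t-rec : ∀ m k → t (suc k) (suc m) + t k m ≡ + 2 * t (suc k) m + t k (suc m)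
t-rec zero k = modulo
  (t-suc (suc k) 0 ⊕ (- 1ℤ) ⊙ t-suc k 0 ⊕ a-rec k 0)
  (ring (t (suc k) 1) (t k 1) (a (suc k) 1) (a k 1))
  where
  ring : ∀ t₁ t₀ a₁ a₀ →
    t₁ + 1ℤ + (1ℤ + a₁ + (- 1ℤ) * (1ℤ + a₀) + (+ 2 * 1ℤ + a₀)) ≡
    + 2 * 1ℤ + t₀ + (t₁ + (- 1ℤ) * t₀ + (a₁ + 1ℤ))
  ring = solve-∀
t-rec (suc m) k = modulo
  (t-suc (suc k) (suc m) ⊕ t-suc k m ⊕ (- + 2) ⊙ t-suc (suc k) m ⊕ (- 1ℤ) ⊙ t-suc k (suc m)
    ⊕ t-rec m (suc k) ⊕ a-rec k (suc m))
  (ring (t (suc k) (2 ℕ.+ m)) (t k (suc m)) (t (suc k) (suc m)) (t k (2 ℕ.+ m))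
        (t (2 ℕ.+ k) (suc m)) (t (suc k) m) (t (2 ℕ.+ k) m)
        (a (suc k) (2 ℕ.+ m)) (a k (suc m)) (a (suc k) (suc m)) (a k (2 ℕ.+ m)))
  where
  ring : ∀ p q r w u v z a₂ a₁ a′₁ a′₂ →
    p + q + (u + a₂ + (v + a₁) + (- + 2) * (z + a′₁) + (- 1ℤ) * (r + a′₂) + (+ 2 * z + r) + (+ 2 * a′₁ + a′₂)) ≡
    + 2 * r + w + (p + q + (- + 2) * r + (- 1ℤ) * w + (u + v) + (a₂ + a₁))
  ring = solve-∀

-- Subtracting `b-suc` from `d-suc` cancels `s k m` and `b 1 m`. What remains moves `d - b` up the
-- chain in `k`, collecting `c k 0 - a k`.
d-y : ∀ m k → d k (suc m) + t k m ≡ y k m + b k (suc m)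
d-y zero k = modulo (d-suc k 0 ⊕ (- 1ℤ) ⊙ b-suc k 0) (ring (d k 1) (b k 1) (s k 0))
  where
  ring : ∀ d b s → d + 1ℤ + (1ℤ + s + 1ℤ + (- 1ℤ) * (1ℤ + s + 1ℤ)) ≡ 1ℤ + b + (d + 1ℤ + (- 1ℤ) * (b + 1ℤ))
  ring = solve-∀
d-y (suc m) k = modulo
  (d-suc k (suc m) ⊕ (- 1ℤ) ⊙ b-suc k (suc m) ⊕ d-y m (suc k) ⊕ t-suc k m)
  (ring (d k (2 ℕ.+ m)) (d (suc k) (suc m)) (b k (2 ℕ.+ m)) (b (suc k) (suc m)) (b 1 (suc m)) (s k (suc m))
        (a k (suc m)) (c k 0 (suc m)) (y (suc k) m) (t k (suc m)) (t (suc k) m))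
  where
  ring : ∀ d d′ b b′ b₁ s a c y′ t t′ →
    d + t + (d′ + s + c + (- 1ℤ) * (b′ + s + a) + (y′ + b′) + (t′ + a)) ≡
    y′ + c + b + (d + b₁ + (- 1ℤ) * (b + b₁) + (d′ + t′) + t)
  ring = solve-∀

y-rec : ∀ m k → y k (2 ℕ.+ m) + y k m + + 2 * t k (suc m) ≡ + 3 * y k (suc m) + t k (2 ℕ.+ m) + t k m
-- At the end of the diagonal `c-rec` covers only the term for `k`; the term for `suc k` is expanded
-- by `c-suc`.
y-rec zero k = modulo
  (c-rec k 0 ⊕ + 2 ⊙ t-suc k 0 ⊕ (- 1ℤ) ⊙ t-suc k 1 ⊕ (- 1ℤ) ⊙ t-suc (suc k) 0 ⊕ c-suc (suc k) 0 0)
  (ring (c k 0 1) (c k 0 2) (c (suc k) 0 1) (t k 1) (t k 2) (t (suc k) 1) (a k 1) (a k 2) (s (suc k) 0))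
  where
  ring : ∀ c₁ c₂ c′ t₁ t₂ t′ a₁ a₂ s →
    (1ℤ + c′ + c₂) + 1ℤ + + 2 * t₁ +
      (+ 3 * c₁ + a₂ + 1ℤ + + 2 * (1ℤ + a₁) + (- 1ℤ) * (t′ + a₂) + (- 1ℤ) * (1ℤ + (s + 1ℤ)) + (s + (1ℤ + + 0 * 1ℤ) + 1ℤ)) ≡
    + 3 * (1ℤ + c₁) + t₂ + 1ℤ +
      (c₂ + 1ℤ + + 2 * a₁ + + 2 * t₁ + (- 1ℤ) * t₂ + (- 1ℤ) * t′ + c′)
  ring = solve-∀
y-rec (suc m) k = modulo
  (y-rec m (suc k) ⊕ c-rec k (suc m) ⊕ + 2 ⊙ t-suc k (suc m) ⊕ (- 1ℤ) ⊙ t-suc k (2 ℕ.+ m) ⊕ (- 1ℤ) ⊙ t-suc k m)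
  (ring (y (suc k) m) (y (suc k) (suc m)) (y (suc k) (2 ℕ.+ m))
        (c k 0 (suc m)) (c k 0 (2 ℕ.+ m)) (c k 0 (3 ℕ.+ m))
        (t k (suc m)) (t k (2 ℕ.+ m)) (t k (3 ℕ.+ m))
        (t (suc k) m) (t (suc k) (suc m)) (t (suc k) (2 ℕ.+ m))
        (a k (suc m)) (a k (2 ℕ.+ m)) (a k (3 ℕ.+ m)))
  where
  ring : ∀ y₀ y₁ y₂ c₁ c₂ c₃ t₁ t₂ t₃ t′₀ t′₁ t′₂ a₁ a₂ a₃ →
    (y₂ + c₃) + (y₀ + c₁) + + 2 * t₂ +
      (+ 3 * y₁ + t′₂ + t′₀ + (+ 3 * c₂ + a₃ + a₁) + + 2 * (t′₁ + a₂) + (- 1ℤ) * (t′₂ + a₃) + (- 1ℤ) * (t′₀ + a₁)) ≡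
    + 3 * (y₁ + c₂) + t₃ + t₁ +
      (y₂ + y₀ + + 2 * t′₁ + (c₃ + c₁ + + 2 * a₂) + + 2 * t₂ + (- 1ℤ) * t₃ + (- 1ℤ) * t₁)
  ring = solve-∀

-- At `k = 1` the system closes: `s 0` is `b 1`, and `b 1 (suc m)` is `t 1 (suc m) - t 1 m` because
-- `β (suc m)` equals `t 1 m`.
t₁-rec : ∀ m → t 1 (2 ℕ.+ m) + + 2 * t 1 m ≡ + 4 * t 1 (suc m)
t₁-rec m = modulo
  (t-suc 1 (suc m) ⊕ t-rec m 1 ⊕ s-suc 0 (suc m) ⊕ (- + 2) ⊙ t-suc 1 m)
  (ring (b 1 m) (b 1 (suc m)) (b 1 (2 ℕ.+ m)) (β m) (t 2 m) (t 2 (suc m)) (a 1 (suc m)) (s 1 (suc m)))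
  where
  ring : ∀ b₀ b₁ b₂ β u₀ u₁ a s → let t₀ = b₀ + β ; t₁ = b₁ + (β + b₀) ; t₂ = b₂ + (β + b₀ + b₁) in
    t₂ + + 2 * t₀ + (u₁ + (s + a) + (+ 2 * u₀ + t₁) + (b₁ + a) + (- + 2) * (u₀ + a)) ≡
    + 4 * t₁ + (t₂ + (u₁ + t₀) + s + (- + 2) * t₁)
  ring = solve-∀

-- What `y-rec` leaves is the second difference of `t 0`. By `t-rec` the first difference is
-- `t 1 (suc m) - 2 * t 1 m`, and `t₁-rec` collapses the second to `t 1 (suc m)`. The labels `A 0`
-- and `B 0` inside `t 0` never occur below `D 0`; they only carry the recurrences down to `k = 0`.
y₀-rec : ∀ m → y 0 (2 ℕ.+ m) + y 0 m ≡ + 3 * y 0 (suc m) + t 1 (suc m)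
y₀-rec m = modulo
  (y-rec m 0 ⊕ (- 1ℤ) ⊙ t-rec (suc m) 0 ⊕ t-rec m 0 ⊕ t₁-rec m)
  (ring (y 0 m) (y 0 (suc m)) (y 0 (2 ℕ.+ m)) (t 0 m) (t 0 (suc m)) (t 0 (2 ℕ.+ m)) (t 1 m) (t 1 (suc m)) (t 1 (2 ℕ.+ m)))
  where
  ring : ∀ y₀ y₁ y₂ u₀ u₁ u₂ t₀ t₁ t₂ →
    y₂ + y₀ + (+ 3 * y₁ + u₂ + u₀ + (- 1ℤ) * (+ 2 * t₁ + u₂) + (+ 2 * t₀ + u₁) + + 4 * t₁) ≡
    + 3 * y₁ + t₁ + (y₂ + y₀ + + 2 * u₁ + (- 1ℤ) * (t₂ + u₁) + (t₁ + u₀) + (t₂ + + 2 * t₀))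
  ring = solve-∀

d₀-suc : ∀ m → d 0 (suc m) + + 3 * t 1 m ≡ y 0 m + t 1 (suc m)
d₀-suc m = modulo (d-y m 0 ⊕ (- 1ℤ) ⊙ t-rec m 0)
  (ring (d 0 (suc m)) (y 0 m) (b 0 (suc m)) (b 1 m) (β m) (t 0 m) (t 1 (suc m)))
  where
  ring : ∀ d y b₀ b₁ β u t →
    d + + 3 * (b₁ + β) + (y + b₀ + (- 1ℤ) * (+ 2 * (b₁ + β) + (b₀ + (β + b₁)))) ≡
    y + t + (d + u + (- 1ℤ) * (t + u))
  ring = solve-∀

d₀-rec : ∀ m → d 0 (4 ℕ.+ m) + + 15 * d 0 (2 ℕ.+ m) + + 2 * d 0 m ≡ + 7 * d 0 (3 ℕ.+ m) + + 10 * d 0 (1 ℕ.+ m)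
-- `d₀-suc` speaks only of `d 0 (suc m)`, so the instance containing `d 0 0` is settled by
-- evaluation.
d₀-rec zero = refl
-- In terms of the shift z, the multipliers are those of the recurrence itself
-- for d₀-suc, z² - 4z + 2 for y₀-rec, and z³ - 6z² + 11z - 3 for t₁-rec.
d₀-rec (suc m) = modulo
  (d₀-suc (4 ℕ.+ m) ⊕ (- + 7) ⊙ d₀-suc (3 ℕ.+ m) ⊕ + 15 ⊙ d₀-suc (2 ℕ.+ m) ⊕ (- + 10) ⊙ d₀-suc (1 ℕ.+ m) ⊕ + 2 ⊙ d₀-suc m
   ⊕ y₀-rec (2 ℕ.+ m) ⊕ (- + 4) ⊙ y₀-rec (1 ℕ.+ m) ⊕ + 2 ⊙ y₀-rec m
   ⊕ t₁-rec (3 ℕ.+ m) ⊕ (- + 6) ⊙ t₁-rec (2 ℕ.+ m) ⊕ + 11 ⊙ t₁-rec (1 ℕ.+ m) ⊕ (- + 3) ⊙ t₁-rec m)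
  (ring (d 0 (1 ℕ.+ m)) (d 0 (2 ℕ.+ m)) (d 0 (3 ℕ.+ m)) (d 0 (4 ℕ.+ m)) (d 0 (5 ℕ.+ m))
        (y 0 m) (y 0 (1 ℕ.+ m)) (y 0 (2 ℕ.+ m)) (y 0 (3 ℕ.+ m)) (y 0 (4 ℕ.+ m))
        (t 1 m) (t 1 (1 ℕ.+ m)) (t 1 (2 ℕ.+ m)) (t 1 (3 ℕ.+ m)) (t 1 (4 ℕ.+ m)) (t 1 (5 ℕ.+ m)))
  where
  ring : ∀ d₁ d₂ d₃ d₄ d₅ y₀ y₁ y₂ y₃ y₄ t₀ t₁ t₂ t₃ t₄ t₅ →
    d₅ + + 15 * d₃ + + 2 * d₁ +
      (y₄ + t₅ + (- + 7) * (y₃ + t₄) + + 15 * (y₂ + t₃) + (- + 10) * (y₁ + t₂) + + 2 * (y₀ + t₁)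
       + (+ 3 * y₃ + t₃) + (- + 4) * (+ 3 * y₂ + t₂) + + 2 * (+ 3 * y₁ + t₁)
       + + 4 * t₄ + (- + 6) * (+ 4 * t₃) + + 11 * (+ 4 * t₂) + (- + 3) * (+ 4 * t₁)) ≡
    + 7 * d₄ + + 10 * d₂ +
      (d₅ + + 3 * t₄ + (- + 7) * (d₄ + + 3 * t₃) + + 15 * (d₃ + + 3 * t₂) + (- + 10) * (d₂ + + 3 * t₁) + + 2 * (d₁ + + 3 * t₀)
       + (y₄ + y₂) + (- + 4) * (y₃ + y₁) + + 2 * (y₂ + y₀)
       + (t₅ + + 2 * t₃) + (- + 6) * (t₄ + + 2 * t₂) + + 11 * (t₃ + + 2 * t₁) + (- + 3) * (t₂ + + 2 * t₀))
  ring = solve-∀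

-- From the recurrence to the generating function

⊘-unique : ∀ {f g : Series} {g₀≡1 : True (g 0 ℤ.≟ 1ℤ)} h → h ⊛ g ≗ f → h ≗ (f ⊘ g) {g₀≡1}
⊘-unique {f} {g} {g₀≡1} h eq zero = begin
  h 0              ≡⟨ ℤ.*-identityʳ (h 0) ⟨
  h 0 * 1ℤ         ≡⟨ cong (h 0 *_) (toWitness g₀≡1) ⟨
  h 0 * g 0        ≡⟨ ℤ.+-identityʳ _ ⟨
  h 0 * g 0 + 0ℤ   ≡⟨ eq 0 ⟩
  f 0              ∎
  where open ≡-Reasoning
⊘-unique {f} {g} {g₀≡1} h eq (suc n) = ⊘-unique {g₀≡1 = g₀≡1} (h ∘ suc) tail n
  where
  tail : ∀ m → ((h ∘ suc) ⊛ g) m ≡ f (suc m) - f 0 * g (suc m)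
  tail m = modulo (eq (suc m) ⊕ (- g (suc m)) ⊙ ⊘-unique {g₀≡1 = g₀≡1} h eq 0)
    (ring (((h ∘ suc) ⊛ g) m) (h 0) (g (suc m)) (f (suc m)) (f 0))
    where
    ring : ∀ x h g f f₀ → x + (f + (- g) * f₀) ≡ f - f₀ * g + (h * g + x + (- g) * h)
    ring = solve-∀

denominator : Series
denominator = poly (+ 1 ∷ - + 3 ∷ + 1 ∷ []) ⊛ poly (+ 1 ∷ - + 4 ∷ + 2 ∷ [])

denominator-vanishes : ∀ n → denominator (5 ℕ.+ n) ≡ 0ℤ
denominator-vanishes n = cong (λ z → 0ℤ + (0ℤ + (0ℤ + z))) (zero-⊛ (poly (+ 1 ∷ - + 4 ∷ + 2 ∷ [])) (2 ℕ.+ n))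
  where
  zero-⊛ : ∀ g n → ((λ _ → 0ℤ) ⊛ g) n ≡ 0ℤ
  zero-⊛ g zero    = refl
  zero-⊛ g (suc n) = cong₂ _+_ (ℤ.*-zeroˡ (g (suc n))) (zero-⊛ g n)

⊛-denominator : ∀ (h : Series) →
  (∀ m → h (4 ℕ.+ m) + + 15 * h (2 ℕ.+ m) + + 2 * h m ≡ + 7 * h (3 ℕ.+ m) + + 10 * h (1 ℕ.+ m)) →
  ∀ n → (h ⊛ denominator) (4 ℕ.+ n) ≡ 0ℤ
⊛-denominator h rec zero = modulo (rec 0) (ring (h 0) (h 1) (h 2) (h 3) (h 4))
  where
  ring : ∀ h₀ h₁ h₂ h₃ h₄ →
    h₀ * + 2 + (h₁ * - + 10 + (h₂ * + 15 + (h₃ * - + 7 + (h₄ * + 1 + 0ℤ)))) + (+ 7 * h₃ + + 10 * h₁) ≡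
    0ℤ + (h₄ + + 15 * h₂ + + 2 * h₀)
  ring = solve-∀
⊛-denominator h rec (suc n) =
  cong₂ _+_ (trans (cong (h 0 *_) (denominator-vanishes n)) (ℤ.*-zeroʳ (h 0)))
            (⊛-denominator (h ∘ suc) (rec ∘ suc) n)

numerator : Series
numerator = poly (+ 1 ∷ - + 6 ∷ + 10 ∷ - + 3 ∷ + 1 ∷ [])

avoiders : Series
avoiders zero    = 1ℤ
avoiders (suc n) = d 0 n

F≗avoiders : F T ≗ avoiders
F≗avoiders zero    = cong +_ (length-S 0)
F≗avoiders (suc n) = cong +_ (length-S-suc n)

avoiders-⊛ : avoiders ⊛ denominator ≗ numerator
avoiders-⊛ 0 = refl
avoiders-⊛ 1 = refl
avoiders-⊛ 2 = refl
avoiders-⊛ 3 = refl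
-- The recurrence of `d 0` does not extend to the empty word: here it is off by 1, the coefficient
-- of x⁴ in the numerator.
avoiders-⊛ 4 = refl
avoiders-⊛ (suc (suc (suc (suc (suc n))))) =
  cong₂ _+_ (cong (1ℤ *_) (denominator-vanishes n)) (⊛-denominator (d 0) d₀-rec n)

theorem18 :
  let T : List Pattern
      T = (2 ∷ 1 ∷ 3 ∷ 4 ∷ []) ∷ (2 ∷ 3 ∷ 4 ∷ 1 ∷ []) ∷ (2 ∷ 4 ∷ 1 ∷ 3 ∷ []) ∷ []
  in F T ≗ poly (+ 1 ∷ - + 6 ∷ + 10 ∷ - + 3 ∷ + 1 ∷ [])
           ⊘ (poly (+ 1 ∷ - + 3 ∷ + 1 ∷ []) ⊛ poly (+ 1 ∷ - + 4 ∷ + 2 ∷ []))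
theorem18 n = trans (F≗avoiders n) (⊘-unique avoiders avoiders-⊛ n)
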